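{- Let $R=(a_h)_{h\ge1}$ be an $\infty$-folding sequence and let $S=(s_h)_{h\in\mathbb{Z}}$ be defined by $s_h=a_h$ and $s_{ -h}=-a_h$ for $h\ge1$, and $s_0=\varepsilon$ for some fixed $\varepsilon\in\{+1,-1\}$ (i.e. $S=(\overline{R},\varepsilon,R)$). Let $C$ be a complete curve with associated sequence $S$, and let $\mathcal{C}$ be a covering of $\mathbb{R}^2$ by complete folding curves which contains $C$ and satisfies the local isomorphism property. (1) If the set $\{n\in\mathbb{N}: a_{2^n}=(-1)^n\}$ is finite or cofinite, then $\mathcal{C}$ consists of exactly $2$ curves whose associated sequences are $S$ (up to a shift of indices) and $4$ other curves. (2) Otherwise, $\mathcal{C}$ consists of exactly $2$ curves, both with associated sequence $S$ (up to a shift of indices).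
   Context: All sequences take values in $\{+1,-1\}$. For $S=(a_1,\dots,a_n)$ write $\overline{S}=(-a_n,\dots,-a_1)$. The $n$-folding sequences are defined recursively: the only $0$-folding sequence is the empty sequence, and the $(n+1)$-folding sequences are exactly $(\overline{S},+1,S)$ and $(\overline{S},-1,S)$ with $S$ an $n$-folding sequence. An $\infty$-folding sequence is a sequence $(a_k)_{k\ge1}$ such that $(a_1,\dots,a_{2^n-1})$ is an $n$-folding sequence for every $n\ge1$. A subword of a sequence $(b_k)$ is a block $(b_{h+1},\dots,b_{h+m})$. A complete folding sequence is a sequence $(a_k)_{k\in\mathbb{Z}}$ each finite subword of which is a subword of some $n$-folding sequence. A segment is an oriented unit edge of $\mathbb{Z}^2$. A complete curve is a sequence $(C_i)_{i\in\mathbb{Z}}$ of segments such that the terminal point of $C_i$ is the initial point of $C_{i+1}$, consecutive supports are perpendicular, and all supports are pairwise distinct (curves differing by an index shift are identified). Its associated sequence is $(\eta_i)_{i\in\mathbb{Z}}$ with $\eta_i=+1$ (resp. $-1$) if one turns left (resp. right) from $C_i$ to $C_{i+1}$. A complete folding curve is a complete curve whose associated sequence is a complete folding sequence. A covering of $\mathbb{R}^2$ by complete folding curves is a set $\mathcal{C}$ of complete folding curves such that every unit edge of $\mathbb{Z}^2$ is the support of exactly one segment of exactly one curve of $\mathcal{C}$. A decorated segment of $\mathcal{C}$ is a segment of a curve of $\mathcal{C}$ together with, at each endpoint, the support of the segment of the same curve which precedes/follows it there. $\mathcal{C}$ satisfies the local isomorphism property if for every finite set $F$ of decorated segments of $\mathcal{C}$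 there is $r>0$ such that every disk of radius $r$ contains a translate $v+F$ ($v\in\mathbb{Z}^2$) which is a set of decorated segments of $\mathcal{C}$. -}

module Defs where

open import Data.Nat as ℕ using (ℕ; zero; suc; _∸_; _^_)
open import Data.Integer as ℤ using (ℤ; +_; -[1+_]; _+_; _-_; _*_; _≤_)
open import Data.Product using (Σ; ∃; ∃-syntax; _×_; _,_; ∃!; proj₁; proj₂)
open import Data.List using (List; []; _∷_; _++_; reverse; map; applyUpTo)
open import Data.List.Relation.Unary.All using (All)
open import Data.Sum using (_⊎_)
open import Function.Definitions using (Injective)
open import Relation.Binary.PropositionalEquality using (_≡_)
open import Relation.Nullary using (¬_)

data Sign : Set where
  plus minus : Sign

neg : Sign → Sign
neg plus  = minus
neg minus = plus

altSign : ℕ → Sign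
altSign zero    = plus
altSign (suc n) = neg (altSign n)

bar : List Sign → List Sign
bar S = reverse (map neg S)

data Folding : ℕ → List Sign → Set where
  fold0 : Folding 0 []
  foldS : ∀ {n S} → Folding n S → (x : Sign) → Folding (suc n) (bar S ++ x ∷ S)

-- A one-sided sequence (a_k)_{k ≥ 1} is represented by R : ℕ → Sign
-- with  R k = a_{k+1}.
-- ∞-folding: (a_1, ..., a_{2^n - 1}) is n-folding for every n ≥ 1.
InfFolding : (ℕ → Sign) → Set
InfFolding R = ∀ (n : ℕ) → Folding (suc n) (applyUpTo R (2 ^ suc n ∸ 1))

twoSided : (ℕ → Sign) → Sign → ℤ → Sign
twoSided R ε (+ zero)  = ε
twoSided R ε (+ suc h) = R h
twoSided R ε -[1+ h ]  = neg (R h)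

block : (ℤ → Sign) → ℤ → ℕ → List Sign
block s h m = applyUpTo (λ i → s (h + + suc i)) m

SubwordOf : List Sign → List Sign → Set
SubwordOf w L = ∃[ u ] ∃[ v ] (u ++ w ++ v ≡ L)

IsCompleteFoldingSeq : (ℤ → Sign) → Set
IsCompleteFoldingSeq s =
  ∀ (h : ℤ) (m : ℕ) → ∃[ n ] ∃[ L ] (Folding n L × SubwordOf (block s h m) L)

ShiftEq : {A : Set} → (ℤ → A) → (ℤ → A) → Set
ShiftEq s t = ∃[ k ] (∀ i → s (i + k) ≡ t i)

Point : Set
Point = ℤ × ℤ

_⊕_ : Point → Point → Point
(a , b) ⊕ (c , d) = (a + c , b + d)

data Dir : Set where
  E N W S : Dir

dirVec : Dir → Point
dirVec E = (+ 1 , + 0)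
dirVec N = (+ 0 , + 1)
dirVec W = (ℤ.- + 1 , + 0)
dirVec S = (+ 0 , ℤ.- + 1)

left : Dir → Dir
left E = N
left N = W
left W = S
left S = E

data Axis : Set where
  horiz vert : Axis

-- a unit edge of ℤ² (unoriented): the edge from p to p+(1,0) (horiz)
-- or from p to p+(0,1) (vert)
Edge : Set
Edge = Point × Axis

Segment : Set
Segment = Point × Dir

start : Segment → Point
start (p , d) = p

end : Segment → Point
end (p , d) = p ⊕ dirVec d

support : Segment → Edge
support (p , E) = (p , horiz)
support (p , N) = (p , vert)
support (p , W) = (p ⊕ dirVec W , horiz)
support (p , S) = (p ⊕ dirVec S , vert)

axis : Dir → Axis
axis E = horiz
axis W = horiz
axis N = vert
axis S = vert

Perp : Edge → Edge → Set
Perp (p , a) (q , b) = ¬ (a ≡ b)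

IsCompleteCurve : (ℤ → Segment) → Set
IsCompleteCurve C =
  (∀ i → end (C i) ≡ start (C (ℤ.suc i)))
  × (∀ i → Perp (support (C i)) (support (C (ℤ.suc i))))
  × Injective _≡_ _≡_ (λ i → support (C i))

-- turning sign from direction d to direction d' (d' perpendicular to d)
turn : Dir → Dir → Sign
turn E N = plus
turn N W = plus
turn W S = plus
turn S E = plus
turn _ _ = minus

assoc : (ℤ → Segment) → ℤ → Sign
assoc C i with C i | C (ℤ.suc i)
... | (_ , d) | (_ , d') = turn d d'

IsCompleteFoldingCurve : (ℤ → Segment) → Set
IsCompleteFoldingCurve C = IsCompleteCurve C × IsCompleteFoldingSeq (assoc C)

-- A set of curves is given as a family  ι : I → (ℤ → Segment).
-- Covering: each curve is a complete folding curve and every unit edge is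
-- the support of exactly one segment of exactly one curve, i.e. there is a
-- unique pair (curve index, position) with that support.  (In particular
-- distinct indices give curves that are not shifts of each other.)
IsCovering : (I : Set) → (I → ℤ → Segment) → Set
IsCovering I ι =
  (∀ i → IsCompleteFoldingCurve (ι i))
  × (∀ (e : Edge) → ∃! _≡_ (λ (p : I × ℤ) → support (ι (proj₁ p) (proj₂ p)) ≡ e))

ContainsCurve : (I : Set) → (I → ℤ → Segment) → (ℤ → Segment) → Set
ContainsCurve I ι C = ∃[ i ] ShiftEq (ι i) C

DecSeg : Set
DecSeg = Edge × Segment × Edge

decorated : (ℤ → Segment) → ℤ → DecSeg
decorated C k = (support (C (k - + 1)) , C k , support (C (k + + 1)))

IsDecSegOf : (I : Set) → (I → ℤ → Segment) → DecSeg → Set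
IsDecSegOf I ι D = ∃[ i ] ∃[ k ] (decorated (ι i) k ≡ D)

translateE : Point → Edge → Edge
translateE v (p , a) = (v ⊕ p , a)

translateD : Point → DecSeg → DecSeg
translateD v (e , (p , d) , e') = (translateE v e , (v ⊕ p , d) , translateE v e')

InDisk : Point → ℕ → Point → Set
InDisk (cx , cy) r (x , y) =
  (x - cx) * (x - cx) + (y - cy) * (y - cy) ≤ + (r ℕ.* r)

SegInDisk : Point → ℕ → DecSeg → Set
SegInDisk c r (_ , s , _) = InDisk c r (start s) × InDisk c r (end s)

LocalIso : (I : Set) → (I → ℤ → Segment) → Set
LocalIso I ι =
  ∀ (F : List DecSeg) → All (IsDecSegOf I ι) F →
    ∃[ r ] ∀ (c : Point) → ∃[ v ]
      (All (SegInDisk c r) (map (translateD v) F)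
       × All (IsDecSegOf I ι) (map (translateD v) F))

-- the set {n ∈ ℕ : a_{2^n} = (-1)^n}  (recall a_{2^n} = R (2^n - 1))

InSetA : (ℕ → Sign) → ℕ → Set
InSetA R n = R (2 ^ n ∸ 1) ≡ altSign n

FiniteOrCofinite : (ℕ → Sign) → Set
FiniteOrCofinite R =
  (∃[ N ] ∀ n → N ℕ.≤ n → ¬ InSetA R n)
  ⊎ (∃[ N ] ∀ n → N ℕ.≤ n → InSetA R n)

{-# OPTIONS --safe #-}
module Submission where

open import Defs
open import Data.Bool using (Bool; true; false; not; _xor_)
open import Data.Empty using (⊥; ⊥-elim)
open import Data.Fin using (Fin; toℕ) renaming (zero to fz; suc to fs)
open import Data.Integer as ℤ using (ℤ; +_; -[1+_]; _+_; _-_; _*_; -_; 0ℤ; 1ℤ)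
import Data.Integer.Properties as ℤP
open import Data.Integer.Tactic.RingSolver using (solve-∀)
open import Data.List using (List; []; _∷_; _++_; length; reverse; map; applyUpTo; applyDownFrom)
import Data.List.Properties as LP
open import Data.List.Relation.Unary.All as All using (All; []; _∷_)
import Data.List.Relation.Unary.All.Properties as AllP
open import Data.List.Relation.Unary.Any as Any using (Any; here; there)
open import Data.Nat as ℕ using (ℕ; zero; suc; _<_; ⌊_/2⌋)
import Data.Nat.Properties as ℕP
open import Data.Nat.Tactic.RingSolver renaming (solve-∀ to nsolve)
open import Data.Product using (Σ; ∃-syntax; _×_; _,_; proj₁; proj₂)
import Data.Product.Properties as ×P
open import Data.Sum using (_⊎_; inj₁; inj₂; [_,_]′)
open import Data.Unit using (⊤; tt)
open import Data.Vec using (Vec; []; _∷_)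
open import Function using (_∘_)
open import Function.Bundles using (_↔_; _⇔_; mk↔ₛ′; mk⇔; Inverse)
open import Relation.Binary.PropositionalEquality
open import Relation.Nullary using (¬_; Dec; yes; no)
open import Relation.Nullary.Decidable using (map′; _×-dec_; toWitness; ¬?)

-- Seen from the vertex between the segments 0 and 1 of C, let ℤ² be the Gaussian integers.  A folding
-- curve alternates between even and odd vertices, its turns at the odd ones alternate, and joining its
-- even vertices gives a folding curve on the lattice (1 ± i) ℤ[i].  Iterating, the turns of C are
-- prescribed at each vertex z ≠ 0 by its (1 + i)-adic valuation and by the signs a_{2^n}.  The curve C
-- covers arbitrarily large disks, and a long piece of C occurs in C only after a translation by an
-- element of a deep level; so the local isomorphism property forces the prescribed turns on the whole
-- covering.  Now every edge has an ancestor at level n, and edges with a common ancestor lie on the same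
-- curve.  In rescaled coordinates the two possible parent maps (for a_{2^n} = ±1) are contractions with a
-- common attractor of 12 edges: the 4 edges at the origin, which are fixed and make up 2 curves, and 4
-- pairs {A, B} with A ↦ B, B ↦ origin for + and B ↦ A, A ↦ origin for -.  So an edge fails to be
-- absorbed by the origin only if the signs a_{2^n} eventually alternate, and in that case each of the 4
-- pairs gives one more curve.  Finally, a curve with sequence S passes through the origin, because the
-- levels of the vertices can be read off the sequence.

-- How curves are told apart: two steps along a curve become one step between parents, so edges at
-- distance m on a curve have equal or consecutive ancestors from level m on. Equality cannot be
-- hoped for, because two successive edges at the origin are their own ancestors. Representatives
-- are therefore compared at levels where their ancestors are explicit, and there it suffices that
-- these are neither equal nor consecutive. Large disks on C come from a finite check: a disk
-- contracts into a translate of the attractor, and for each word of seven signs some translate of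
-- the whole attractor has one common ancestor. In the use of local isomorphism, the recurring
-- pattern consists of a decorated segment of the covering and a piece of C. The piece is a ruler:
-- its reappearance on C is a period of S on a window, and such a period is divisible by a power of
-- 2, which locates the displacement. The origin lies in all levels and escapes this argument; its
-- turn is copied from the piece itself. Each level uses rescaled coordinates, so the same
-- definitions serve all levels and only the sign sequence is shifted.

infixl 7 _·_
_·_ : Sign → Sign → Sign
plus  · s = s
minus · s = neg s

neg-neg : ∀ s → neg (neg s) ≡ s
neg-neg plus  = refl
neg-neg minus = refl

neg≢ : ∀ {s} → ¬ (neg s ≡ s)
neg≢ {plus}  ()
neg≢ {minus} ()

neg-·ˡ : ∀ s t → neg s · t ≡ neg (s · t)
neg-·ˡ plus  t = refl
neg-·ˡ minus t = sym (neg-neg t)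

·-neg : ∀ s t → s · neg t ≡ neg (s · t)
·-neg plus  t = refl
·-neg minus t = refl

·-plus : ∀ s → s · plus ≡ s
·-plus plus  = refl
·-plus minus = refl

·-minus : ∀ s → s · minus ≡ neg s
·-minus plus  = refl
·-minus minus = refl

-- Parity and halving of integers.

ℤ-ind : (P : ℤ → Set) → P 0ℤ → (∀ z → P z → P (ℤ.suc z)) → (∀ z → P (ℤ.suc z) → P z) → ∀ z → P z
ℤ-ind P p0 up down (+ zero)       = p0
ℤ-ind P p0 up down (+ suc n)      = up (+ n) (ℤ-ind P p0 up down (+ n))
ℤ-ind P p0 up down -[1+ zero ]    = down -[1+ 0 ] p0
ℤ-ind P p0 up down -[1+ suc n ]   = down -[1+ suc n ] (ℤ-ind P p0 up down -[1+ n ])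

parityℤ : ℤ → Sign
parityℤ z = altSign ℤ.∣ z ∣

parityℤ-suc : ∀ z → parityℤ (ℤ.suc z) ≡ neg (parityℤ z)
parityℤ-suc (+ n)          = refl
parityℤ-suc -[1+ zero ]    = refl
parityℤ-suc -[1+ suc n ]   = sym (neg-neg _)

parityℤ-neg : ∀ z → parityℤ (- z) ≡ parityℤ z
parityℤ-neg z = cong altSign (ℤP.∣-i∣≡∣i∣ z)

parityℤ-+ : ∀ a b → parityℤ (a + b) ≡ parityℤ a · parityℤ b
parityℤ-+ a b = ℤ-ind (λ a → parityℤ (a + b) ≡ parityℤ a · parityℤ b) (cong parityℤ (ℤP.+-identityˡ b)) up down a
  where
  e : ∀ z → parityℤ (ℤ.suc z + b) ≡ neg (parityℤ (z + b))
  e z = trans (cong parityℤ (ℤP.+-assoc 1ℤ z b)) (parityℤ-suc (z + b))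
  up : ∀ z → parityℤ (z + b) ≡ parityℤ z · parityℤ b → parityℤ (ℤ.suc z + b) ≡ parityℤ (ℤ.suc z) · parityℤ b
  up z ih rewrite e z | ih | parityℤ-suc z = sym (neg-·ˡ (parityℤ z) (parityℤ b))
  down : ∀ z → parityℤ (ℤ.suc z + b) ≡ parityℤ (ℤ.suc z) · parityℤ b → parityℤ (z + b) ≡ parityℤ z · parityℤ b
  down z ih rewrite e z | parityℤ-suc z | neg-·ˡ (parityℤ z) (parityℤ b) =
    trans (sym (neg-neg _)) (trans (cong neg ih) (neg-neg _))

·-self : ∀ s → s · s ≡ plus
·-self plus  = refl
·-self minus = refl

parityℤ-dbl : ∀ h → parityℤ (h + h) ≡ plus
parityℤ-dbl h = trans (parityℤ-+ h h) (·-self (parityℤ h))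

parityℤ-sub : ∀ a b → parityℤ (a - b) ≡ parityℤ a · parityℤ b
parityℤ-sub a b = trans (parityℤ-+ a (- b)) (cong (parityℤ a ·_) (parityℤ-neg b))

data Par : ℤ → Set where
  ev : ∀ h → Par (h + h)
  od : ∀ h → Par (ℤ.suc (h + h))

suc-dbl : ∀ h → + 1 + h + (+ 1 + h) ≡ + 1 + (+ 1 + (h + h))
suc-dbl = solve-∀

pred-dbl : ∀ h → + 1 + (h - + 1 + (h - + 1)) ≡ h + h - + 1
pred-dbl = solve-∀

pred-suc : ∀ z → (+ 1 + z) - + 1 ≡ z
pred-suc = solve-∀

suc-pred : ∀ z → + 1 + (z - + 1) ≡ z
suc-pred = solve-∀

Par-suc : ∀ z → Par z → Par (ℤ.suc z)
Par-suc _ (ev h) = od h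
Par-suc _ (od h) = subst Par (suc-dbl h) (ev (ℤ.suc h))

Par-pred : ∀ z → Par z → Par (z - + 1)
Par-pred _ (ev h) = subst Par (pred-dbl h) (od (h - + 1))
Par-pred _ (od h) = subst Par (sym (pred-suc (h + h))) (ev h)

parity : ∀ z → Par z
parity = ℤ-ind Par (ev 0ℤ) Par-suc (λ z p → subst Par (pred-suc z) (Par-pred _ p))

half : ℤ → ℤ
half (+ n)     = + ⌊ n /2⌋
half -[1+ n ]  = -[1+ ⌊ n /2⌋ ]

half-dbl : ∀ h → half (h + h) ≡ h
half-dbl (+ n)     = cong +_ (sym (ℕP.n≡⌊n+n/2⌋ n))
half-dbl -[1+ n ]  = cong -[1+_] (sym (ℕP.n≡⌈n+n/2⌉ n))

dbl-half : ∀ z → parityℤ z ≡ plus → half z + half z ≡ z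
dbl-half z p with parity z
... | ev h = cong₂ _+_ (half-dbl h) (half-dbl h)
... | od h with trans (sym p) (trans (parityℤ-suc (h + h)) (cong neg (parityℤ-dbl h)))
...   | ()

-- Gaussian integers

infix 21 ⊝_
⊝_ : Point → Point
⊝ (x , y) = (- x , - y)

O : Point
O = (0ℤ , 0ℤ)

-- multiplication by 1 + i or 1 - i
β : Sign → Point → Point
β plus  (x , y) = (x - y , x + y)
β minus (x , y) = (x + y , y - x)

-- β s v = β plus (δ s v)
δ : Sign → Point → Point
δ plus  v       = v
δ minus (x , y) = (y , - x)

pt : Point → Point
pt = β plus

-- Division by 1 + i or 1 - i, exact for even points only (`β-quo`).
quo : Sign → Point → Point
quo plus  (x , y) = (half (x + y) , half (x + y) - x)
quo minus (x , y) = (half (x + y) - y , half (x + y))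

parityP : Point → Sign
parityP (x , y) = parityℤ (x + y)

p≡ : ∀ {x x' y y' : ℤ} → x ≡ x' → y ≡ y' → (x , y) ≡ (x' , y')
p≡ = cong₂ _,_

⊕-comm : ∀ u v → u ⊕ v ≡ v ⊕ u
⊕-comm (a , b) (c , d) = p≡ (ℤP.+-comm a c) (ℤP.+-comm b d)

⊕-assoc : ∀ u v w → (u ⊕ v) ⊕ w ≡ u ⊕ (v ⊕ w)
⊕-assoc (a , b) (c , d) (e , f) = p≡ (ℤP.+-assoc a c e) (ℤP.+-assoc b d f)

⊕-idʳ : ∀ u → u ⊕ O ≡ u
⊕-idʳ (a , b) = p≡ (ℤP.+-identityʳ a) (ℤP.+-identityʳ b)

⊕-idˡ : ∀ u → O ⊕ u ≡ u
⊕-idˡ (a , b) = p≡ (ℤP.+-identityˡ a) (ℤP.+-identityˡ b)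

⊕-invʳ : ∀ u → u ⊕ ⊝ u ≡ O
⊕-invʳ (a , b) = p≡ (ℤP.+-inverseʳ a) (ℤP.+-inverseʳ b)

⊕-⊝ : ∀ u v → (u ⊕ v) ⊕ ⊝ v ≡ u
⊕-⊝ u v = trans (⊕-assoc u v (⊝ v)) (trans (cong (u ⊕_) (⊕-invʳ v)) (⊕-idʳ u))

⊝-⊕ : ∀ u v → (u ⊕ ⊝ v) ⊕ v ≡ u
⊝-⊕ u v = trans (⊕-assoc u (⊝ v) v) (trans (cong (u ⊕_) (trans (⊕-comm (⊝ v) v) (⊕-invʳ v))) (⊕-idʳ u))

⊕-cancelʳ : ∀ {u v} w → u ⊕ w ≡ v ⊕ w → u ≡ v
⊕-cancelʳ {u} {v} w q = trans (sym (⊕-⊝ u w)) (trans (cong (_⊕ ⊝ w) q) (⊕-⊝ v w))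

⊕-cancelˡ : ∀ {u v} w → w ⊕ u ≡ w ⊕ v → u ≡ v
⊕-cancelˡ {u} {v} w q = ⊕-cancelʳ w (trans (⊕-comm u w) (trans q (⊕-comm w v)))

β-⊕ : ∀ c u v → β c (u ⊕ v) ≡ β c u ⊕ β c v
β-⊕ plus  (a , b) (x , y) = p≡ (l1 a x b y) (l2 a x b y)
  where
  l1 : ∀ a x b y → (a + x) - (b + y) ≡ (a - b) + (x - y)
  l1 = solve-∀
  l2 : ∀ a x b y → (a + x) + (b + y) ≡ (a + b) + (x + y)
  l2 = solve-∀
β-⊕ minus (a , b) (x , y) = p≡ (l2 a x b y) (l1 b y a x)
  where
  l1 : ∀ a x b y → (a + x) - (b + y) ≡ (a - b) + (x - y)
  l1 = solve-∀
  l2 : ∀ a x b y → (a + x) + (b + y) ≡ (a + b) + (x + y)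
  l2 = solve-∀

β-comm : ∀ c c' u → β c (β c' u) ≡ β c' (β c u)
β-comm plus  plus  u = refl
β-comm minus minus u = refl
β-comm plus  minus (x , y) = p≡ (l1 x y) (l2 x y)
  where
  l1 : ∀ x y → x + y - (y - x) ≡ x - y + (x + y)
  l1 = solve-∀
  l2 : ∀ x y → x + y + (y - x) ≡ x + y - (x - y)
  l2 = solve-∀
β-comm minus plus  u = sym (β-comm plus minus u)

β-δ : ∀ c v → pt (δ c v) ≡ β c v
β-δ plus  v       = refl
β-δ minus (x , y) = p≡ (l1 x y) refl
  where
  l1 : ∀ x y → y - - x ≡ x + y
  l1 = solve-∀

β-⊝ : ∀ c v → β c (⊝ v) ≡ ⊝ β c v
β-⊝ plus  (x , y) = p≡ (l1 x y) (l2 x y)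
  where
  l1 : ∀ x y → - x - - y ≡ - (x - y)
  l1 = solve-∀
  l2 : ∀ x y → - x + - y ≡ - (x + y)
  l2 = solve-∀
β-⊝ minus (x , y) = p≡ (l2 x y) (l1 y x)
  where
  l1 : ∀ x y → - x - - y ≡ - (x - y)
  l1 = solve-∀
  l2 : ∀ x y → - x + - y ≡ - (x + y)
  l2 = solve-∀

β-O : ∀ c → β c O ≡ O
β-O plus  = refl
β-O minus = refl

β-plus-sum : ∀ x y → x - y + (x + y) ≡ x + x
β-plus-sum = solve-∀

β-minus-sum : ∀ x y → x + y + (y - x) ≡ y + y
β-minus-sum = solve-∀

parityP-β : ∀ c w → parityP (β c w) ≡ plus
parityP-β plus  (x , y) = trans (cong parityℤ (β-plus-sum x y)) (parityℤ-dbl x)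
parityP-β minus (x , y) = trans (cong parityℤ (β-minus-sum x y)) (parityℤ-dbl y)

parityP-⊕ : ∀ u v → parityP (u ⊕ v) ≡ parityP u · parityP v
parityP-⊕ (a , b) (x , y) = trans (cong parityℤ (l a b x y)) (parityℤ-+ (a + b) (x + y))
  where
  l : ∀ a b x y → a + x + (b + y) ≡ a + b + (x + y)
  l = solve-∀

parityP-⊝ : ∀ u → parityP (⊝ u) ≡ parityP u
parityP-⊝ (x , y) = trans (cong parityℤ (sym (ℤP.neg-distrib-+ x y))) (parityℤ-neg (x + y))

parityP-δ : ∀ s v → parityP (δ s v) ≡ parityP v
parityP-δ plus  v       = refl
parityP-δ minus (x , y) =
  trans (parityℤ-sub y x) (trans (sym (parityℤ-+ y x)) (cong parityℤ (ℤP.+-comm y x)))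

quo-β : ∀ c w → quo c (β c w) ≡ w
quo-β plus (x , y) = p≡ h (trans (cong (_- (x - y)) h) (l x y))
  where
  h : half (x - y + (x + y)) ≡ x
  h = trans (cong half (β-plus-sum x y)) (half-dbl x)
  l : ∀ x y → x - (x - y) ≡ y
  l = solve-∀
quo-β minus (x , y) = p≡ (trans (cong (_- (y - x)) h) (l y x)) h
  where
  h : half (x + y + (y - x)) ≡ y
  h = trans (cong half (β-minus-sum x y)) (half-dbl y)
  l : ∀ x y → x - (x - y) ≡ y
  l = solve-∀

β-quo : ∀ c w → parityP w ≡ plus → β c (quo c w) ≡ w
β-quo plus (x , y) p = p≡ (l1 h x) (trans (l2 h x) (trans (cong (_- x) (dbl-half (x + y) p)) (l3 x y)))
  where
  h = half (x + y)
  l1 : ∀ h x → h - (h - x) ≡ x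
  l1 = solve-∀
  l2 : ∀ h x → h + (h - x) ≡ h + h - x
  l2 = solve-∀
  l3 : ∀ x y → x + y - x ≡ y
  l3 = solve-∀
β-quo minus (x , y) p = p≡ (trans (l2 h y) (trans (cong (_- y) (dbl-half (x + y) p)) (l3 x y))) (l1 h y)
  where
  h = half (x + y)
  l1 : ∀ h x → h - (h - x) ≡ x
  l1 = solve-∀
  l2 : ∀ h x → h - x + h ≡ h + h - x
  l2 = solve-∀
  l3 : ∀ x y → x + y - y ≡ x
  l3 = solve-∀

β-inj : ∀ c {u v} → β c u ≡ β c v → u ≡ v
β-inj c {u} {v} q = trans (sym (quo-β c u)) (trans (cong (quo c) q) (quo-β c v))

-- Directions and quarter turns.

right opp : Dir → Dir
right E = S
right N = E
right W = N
right S = W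
opp E = W
opp N = S
opp W = E
opp S = N

turnBy : Sign → Dir → Dir
turnBy plus  = left
turnBy minus = right

dirVec-opp : ∀ d → dirVec (opp d) ≡ ⊝ dirVec d
dirVec-opp E = refl
dirVec-opp N = refl
dirVec-opp W = refl
dirVec-opp S = refl

rotate : Sign → Point → Point
rotate plus  (x , y) = (- y , x)
rotate minus (x , y) = (y , - x)

dirVec-turnBy : ∀ s d → dirVec (turnBy s d) ≡ rotate s (dirVec d)
dirVec-turnBy plus E = refl
dirVec-turnBy plus N = refl
dirVec-turnBy plus W = refl
dirVec-turnBy plus S = refl
dirVec-turnBy minus E = refl
dirVec-turnBy minus N = refl
dirVec-turnBy minus W = refl
dirVec-turnBy minus S = refl

opp-opp : ∀ d → opp (opp d) ≡ d
opp-opp E = refl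
opp-opp N = refl
opp-opp W = refl
opp-opp S = refl

turnBy-opp : ∀ s d → turnBy s (opp d) ≡ opp (turnBy s d)
turnBy-opp plus E = refl
turnBy-opp plus N = refl
turnBy-opp plus W = refl
turnBy-opp plus S = refl
turnBy-opp minus E = refl
turnBy-opp minus N = refl
turnBy-opp minus W = refl
turnBy-opp minus S = refl

turnBy-turnBy : ∀ s d → turnBy s (turnBy s d) ≡ opp d
turnBy-turnBy plus E = refl
turnBy-turnBy plus N = refl
turnBy-turnBy plus W = refl
turnBy-turnBy plus S = refl
turnBy-turnBy minus E = refl
turnBy-turnBy minus N = refl
turnBy-turnBy minus W = refl
turnBy-turnBy minus S = refl

turnBy-neg : ∀ s d → turnBy (neg s) d ≡ opp (turnBy s d)
turnBy-neg plus E = refl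
turnBy-neg plus N = refl
turnBy-neg plus W = refl
turnBy-neg plus S = refl
turnBy-neg minus E = refl
turnBy-neg minus N = refl
turnBy-neg minus W = refl
turnBy-neg minus S = refl

turnBy-comm : ∀ s t d → turnBy s (turnBy t d) ≡ turnBy t (turnBy s d)
turnBy-comm plus plus d = refl
turnBy-comm minus minus d = refl
turnBy-comm plus minus E = refl
turnBy-comm plus minus N = refl
turnBy-comm plus minus W = refl
turnBy-comm plus minus S = refl
turnBy-comm minus plus E = refl
turnBy-comm minus plus N = refl
turnBy-comm minus plus W = refl
turnBy-comm minus plus S = refl

parityP-dirVec : ∀ d → parityP (dirVec d) ≡ minus
parityP-dirVec E = refl
parityP-dirVec N = refl
parityP-dirVec W = refl
parityP-dirVec S = refl

-- Edges and their parents

-- (w , d) is the edge joining the even vertex pt w to its neighbour in the direction d; thus every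
-- unoriented edge is represented once.  In units of 1 ± i its two halves are again such edges, the far
-- half being based at the image of the other (odd) endpoint.

State : Set
State = Point × Dir

nearHalf farHalf : Sign → State → State
nearHalf c (w , d) = (β c w , d)
farHalf c (w , d) = (β c w ⊕ δ c (dirVec d) , opp (turnBy c d))

-- The first sign is the parity of the base: near halves are based at multiples of 1 ± i and far
-- halves at such a multiple plus a unit, so the parity tells which of the two constructions has to
-- be inverted.
parentBy : Sign → Sign → State → State
parentBy plus  c (w , d) = (quo c w , d)
parentBy minus c (w , d) = (quo c (w ⊕ ⊝ δ c (dirVec (turnBy c d))) , turnBy c d)

parent : Sign → State → State
parent c e = parentBy (parityP (proj₁ e)) c e

turnBy-opp-turnBy : ∀ c d → turnBy c (opp (turnBy c d)) ≡ d
turnBy-opp-turnBy c d = trans (turnBy-opp c (turnBy c d)) (trans (cong opp (turnBy-turnBy c d)) (opp-opp d))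

parityP-farHalf : ∀ c w d → parityP (β c w ⊕ δ c (dirVec d)) ≡ minus
parityP-farHalf c w d rewrite parityP-⊕ (β c w) (δ c (dirVec d)) | parityP-β c w | parityP-δ c (dirVec d) = parityP-dirVec d

parent-nearHalf : ∀ c e → parent c (nearHalf c e) ≡ e
parent-nearHalf c (w , d) rewrite parityP-β c w | quo-β c w = refl

parent-farHalf : ∀ c e → parent c (farHalf c e) ≡ e
parent-farHalf c (w , d) rewrite parityP-farHalf c w d | turnBy-opp-turnBy c d | ⊕-⊝ (β c w) (δ c (dirVec d)) | quo-β c w = refl

parent-view : ∀ c e → (e ≡ nearHalf c (parent c e)) ⊎ (e ≡ farHalf c (parent c e))
parent-view c (w , d) with parityP w in eq
... | plus  = inj₁ (cong (_, d) (sym (β-quo c w eq)))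
... | minus = inj₂ (cong₂ _,_ (sym (trans (cong (_⊕ δ c (dirVec (turnBy c d))) (β-quo c _ eq')) (⊝-⊕ w _)))
                              (sym (trans (cong opp (turnBy-turnBy c d)) (opp-opp d))))
  where
  eq' : parityP (w ⊕ ⊝ δ c (dirVec (turnBy c d))) ≡ plus
  eq' rewrite parityP-⊕ w (⊝ δ c (dirVec (turnBy c d))) | parityP-⊝ (δ c (dirVec (turnBy c d))) | parityP-δ c (dirVec (turnBy c d)) | parityP-dirVec (turnBy c d) | eq = refl

plus≢minus : ¬ (plus ≡ minus)
plus≢minus ()

axis-opp : ∀ d → axis (opp d) ≡ axis d
axis-opp E = refl
axis-opp N = refl
axis-opp W = refl
axis-opp S = refl

sameAxis : Axis → Axis → Bool
sameAxis horiz horiz = true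
sameAxis vert  vert  = true
sameAxis horiz vert  = false
sameAxis vert  horiz = false

sameAxis-turnBy : ∀ a s d → sameAxis a (axis (turnBy s d)) ≡ not (sameAxis a (axis d))
sameAxis-turnBy horiz plus E = refl
sameAxis-turnBy horiz plus N = refl
sameAxis-turnBy horiz plus W = refl
sameAxis-turnBy horiz plus S = refl
sameAxis-turnBy horiz minus E = refl
sameAxis-turnBy horiz minus N = refl
sameAxis-turnBy horiz minus W = refl
sameAxis-turnBy horiz minus S = refl
sameAxis-turnBy vert plus E = refl
sameAxis-turnBy vert plus N = refl
sameAxis-turnBy vert plus W = refl
sameAxis-turnBy vert plus S = refl
sameAxis-turnBy vert minus E = refl
sameAxis-turnBy vert minus N = refl
sameAxis-turnBy vert minus W = refl
sameAxis-turnBy vert minus S = refl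

δ-rotate-neg : ∀ c v → δ c v ⊕ δ (neg c) (⊝ rotate c v) ≡ O
δ-rotate-neg plus  (x , y) = p≡ (ℤP.+-inverseʳ x) (l y)
  where
  l : ∀ y → y - - - y ≡ + 0
  l = solve-∀
δ-rotate-neg minus (x , y) = p≡ (ℤP.+-inverseʳ y) (ℤP.+-inverseʳ (- x))

-- Multiplied by 1 + i, this is the image under `β c` of the identity `β s v` = v + `rotate s v`: a
-- diagonal is two sides of a unit square.
δ-split : ∀ c s v → β c (δ s v) ⊕ δ c (⊝ rotate s v) ≡ δ c v
δ-split plus plus (x , y) = p≡ (l1 x y) (l2 x y)
  where
  l1 : ∀ x y → x - y + - - y ≡ x
  l1 = solve-∀
  l2 : ∀ x y → x + y + - x ≡ y
  l2 = solve-∀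
δ-split plus minus (x , y) = p≡ (l1 x y) (l2 x y)
  where
  l1 : ∀ x y → y - - x + - y ≡ x
  l1 = solve-∀
  l2 : ∀ x y → y + - x + - - x ≡ y
  l2 = solve-∀
δ-split minus plus (x , y) = p≡ (l1 x y) (l2 x y)
  where
  l1 : ∀ x y → x + y + - x ≡ y
  l1 = solve-∀
  l2 : ∀ x y → y - x + - - - y ≡ - x
  l2 = solve-∀
δ-split minus minus (x , y) = p≡ (l1 x y) (l2 x y)
  where
  l1 : ∀ x y → y + - x + - - x ≡ y
  l1 = solve-∀
  l2 : ∀ x y → - x - y + - - y ≡ - x
  l2 = solve-∀

norm : Point → ℕ
norm (x , y) = ℤ.∣ x ∣ ℕ.* ℤ.∣ x ∣ ℕ.+ ℤ.∣ y ∣ ℕ.* ℤ.∣ y ∣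

+sq : ∀ x → + (ℤ.∣ x ∣ ℕ.* ℤ.∣ x ∣) ≡ x * x
+sq (+ n)     = ℤP.pos-* n n
+sq -[1+ n ]  = refl

+nn : ∀ z → + norm z ≡ proj₁ z * proj₁ z + proj₂ z * proj₂ z
+nn (x , y) = cong₂ _+_ (+sq x) (+sq y)

norm-β : ∀ c z → norm (β c z) ≡ norm z ℕ.+ norm z
norm-β plus z@(x , y) = ℤP.+-injective (trans (+nn (β plus z)) (trans (l x y) (sym (cong₂ _+_ (+nn z) (+nn z)))))
  where
  l : ∀ x y → (x - y) * (x - y) + (x + y) * (x + y) ≡ x * x + y * y + (x * x + y * y)
  l = solve-∀
norm-β minus z@(x , y) = ℤP.+-injective (trans (+nn (β minus z)) (trans (l x y) (sym (cong₂ _+_ (+nn z) (+nn z)))))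
  where
  l : ∀ x y → (x + y) * (x + y) + (y - x) * (y - x) ≡ x * x + y * y + (x * x + y * y)
  l = solve-∀

sq≡0 : ∀ x → ℤ.∣ x ∣ ℕ.* ℤ.∣ x ∣ ≡ 0 → x ≡ 0ℤ
sq≡0 x q = ℤP.∣i∣≡0⇒i≡0 ([ (λ p → p) , (λ p → p) ]′ (ℕP.m*n≡0⇒m≡0∨n≡0 ℤ.∣ x ∣ q))

nn≡0 : ∀ z → norm z ≡ 0 → z ≡ O
nn≡0 (x , y) q = p≡ (sq≡0 x (ℕP.m+n≡0⇒m≡0 _ q)) (sq≡0 y (ℕP.m+n≡0⇒n≡0 (ℤ.∣ x ∣ ℕ.* ℤ.∣ x ∣) q))

-- The common step of the inductions on a bound: halving a norm or an index lowers any positive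
-- bound by one, even when the halved quantity is 0.
halve-≤ : ∀ m {n} → m ℕ.+ m ℕ.≤ suc n → m ℕ.≤ n
halve-≤ zero    _ = ℕ.z≤n
halve-≤ (suc m) p = ℕP.≤-trans (ℕP.m≤n+m (suc m) m) (ℕ.s≤s⁻¹ p)

tail : (ℕ → Sign) → ℕ → Sign
tail c n = c (suc n)

-- Transverse to the axis, hence constant along an edge on that axis. This is why the turn at the
-- far end of an outgoing edge can be read from its base.
coord : Axis → Point → ℤ
coord vert  (x , y) = x
coord horiz (x , y) = y

parityℤ-x-y : ∀ x y → parityℤ (x - y) ≡ parityℤ (x + y)
parityℤ-x-y x y = trans (parityℤ-sub x y) (sym (parityℤ-+ x y))

parityℤ-coord : ∀ a w d → sameAxis a (axis d) ≡ true → parityℤ (coord a (pt w ⊕ dirVec d)) ≡ parityP w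
parityℤ-coord vert  (x , y) N _ = trans (cong parityℤ (ℤP.+-identityʳ (x - y))) (parityℤ-x-y x y)
parityℤ-coord vert  (x , y) S _ = trans (cong parityℤ (ℤP.+-identityʳ (x - y))) (parityℤ-x-y x y)
parityℤ-coord horiz (x , y) E _ = cong parityℤ (ℤP.+-identityʳ (x + y))
parityℤ-coord horiz (x , y) W _ = cong parityℤ (ℤP.+-identityʳ (x + y))

-- Orientation of the edges and prediction of the turns.

module Oriented (a : Axis) (ε : Sign) where

  -- a is the axis of the segments leaving even vertices; segments arrive there along the other axis.
  out : Dir → Bool
  out d = sameAxis a (axis d)

  isOut : State → Bool
  isOut e = out (proj₂ e)

  out-opp : ∀ d → out (opp d) ≡ out d
  out-opp d = cong (sameAxis a) (axis-opp d)

  out-turnBy : ∀ s d → out (turnBy s d) ≡ not (out d)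
  out-turnBy = sameAxis-turnBy a

  out-opp-turnBy : ∀ s d → out (opp (turnBy s d)) ≡ not (out d)
  out-opp-turnBy s d = trans (out-opp (turnBy s d)) (out-turnBy s d)

  out-turnBy-opp : ∀ s d → out (turnBy s (opp d)) ≡ not (out d)
  out-turnBy-opp s d = trans (out-turnBy s (opp d)) (cong not (out-opp d))

  -- An outgoing edge ends at an odd vertex, so its successor has to be based at its own far end and
  -- is seen backwards from there; an incoming edge and its successor share their base.
  nxBy : Bool → Sign → State → State
  nxBy true  s (w , d) = (w ⊕ δ s (dirVec d) , opp (turnBy s d))
  nxBy false s (w , d) = (w , turnBy s (opp d))

  nx : Sign → State → State
  nx s e = nxBy (isOut e) s e

  isOut-nx : ∀ s e → isOut (nx s e) ≡ not (isOut e)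
  isOut-nx s (w , d) with out d in eq
  ... | true  = trans (out-opp-turnBy s d) (cong not eq)
  ... | false = trans (out-turnBy-opp s d) (cong not eq)

  pick : Bool → Sign → State → State
  pick false = nearHalf
  pick true  = farHalf

  -- One half of an edge leaves an even vertex and the other arrives at one. Along the edge the half
  -- with `true` comes first, whichever of the two is the near half.
  half-of : Sign → Bool → State → State
  half-of c b e = pick (b xor isOut e) c e

  half-of-out : ∀ c b e → isOut (half-of c b e) ≡ b
  half-of-out c true  (w , d) with out d in eq
  ... | true  = eq
  ... | false = trans (out-opp-turnBy c d) (cong not eq)
  half-of-out c false (w , d) with out d in eq
  ... | true  = trans (out-opp-turnBy c d) (cong not eq)
  ... | false = eq

  parent-half-of : ∀ c b e → parent c (half-of c b e) ≡ e
  parent-half-of c b e with b xor isOut e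
  ... | false = parent-nearHalf c e
  ... | true  = parent-farHalf c e

  xor-self : ∀ b → b xor b ≡ false
  xor-self true  = refl
  xor-self false = refl

  not-xor : ∀ b → not b xor b ≡ true
  not-xor true  = refl
  not-xor false = refl

  half-of-parent : ∀ c e → half-of c (isOut e) (parent c e) ≡ e
  half-of-parent c e with parent-view c e
  ... | inj₁ q = trans (cong (λ b → pick b c (parent c e)) k) (sym q)
    where
    k : isOut e xor isOut (parent c e) ≡ false
    k = trans (cong (_xor isOut (parent c e)) (cong isOut q)) (xor-self (isOut (parent c e)))
  ... | inj₂ q = trans (cong (λ b → pick b c (parent c e)) k) (sym q)
    where
    k : isOut e xor isOut (parent c e) ≡ true
    k = trans (cong (_xor isOut (parent c e)) (trans (cong isOut q) (out-opp-turnBy c (proj₂ (parent c e))))) (not-xor (isOut (parent c e)))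

  parent-inj : ∀ c e f → isOut e ≡ isOut f → parent c e ≡ parent c f → e ≡ f
  parent-inj c e f q p = trans (sym (half-of-parent c e)) (trans (cong₂ (half-of c) q p) (half-of-parent c f))

  -- Seen from its base, an edge is folded with sign c. Traversed towards the base it is folded the
  -- other way, and then the half that comes first is the far one, whose base is odd; the factor
  -- `parityP` accounts for this.
  nx-half-of-out : ∀ c P → nx (c · parityP (proj₁ (half-of c true P))) (half-of c true P) ≡ half-of c false P
  nx-half-of-out c (q , d) with out d in eq
  ... | true rewrite parityP-β c q | ·-plus c | eq = refl
  ... | false rewrite parityP-farHalf c q d | ·-minus c | out-opp-turnBy c d | eq =
    cong₂ _,_ l1 l2
    where
    l1 : (β c q ⊕ δ c (dirVec d)) ⊕ δ (neg c) (dirVec (opp (turnBy c d))) ≡ β c q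
    l1 rewrite dirVec-opp (turnBy c d) | dirVec-turnBy c d =
      trans (⊕-assoc (β c q) (δ c (dirVec d)) (δ (neg c) (⊝ rotate c (dirVec d))))
        (trans (cong (β c q ⊕_) (δ-rotate-neg c (dirVec d))) (⊕-idʳ (β c q)))
    l2 : opp (turnBy (neg c) (opp (turnBy c d))) ≡ d
    l2 rewrite turnBy-neg c (opp (turnBy c d)) | opp-opp (turnBy c (opp (turnBy c d))) = turnBy-opp-turnBy c d

  nx-half-of-in : ∀ c s P → nx s (half-of c false P) ≡ half-of c true (nx s P)
  nx-half-of-in c s (q , d) with out d in eq
  ... | true rewrite out-opp-turnBy c d | out-opp-turnBy s d | eq = cong₂ _,_ (sym l1) l2
    where
    l1 : β c (q ⊕ δ s (dirVec d)) ⊕ δ c (dirVec (opp (turnBy s d))) ≡ β c q ⊕ δ c (dirVec d)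
    l1 rewrite dirVec-opp (turnBy s d) | dirVec-turnBy s d | β-⊕ c q (δ s (dirVec d)) =
      trans (⊕-assoc (β c q) (β c (δ s (dirVec d))) (δ c (⊝ rotate s (dirVec d)))) (cong (β c q ⊕_) (δ-split c s (dirVec d)))
    l2 : turnBy s (opp (opp (turnBy c d))) ≡ opp (turnBy c (opp (turnBy s d)))
    l2 rewrite opp-opp (turnBy c d) | turnBy-opp c (turnBy s d) | opp-opp (turnBy c (turnBy s d)) = turnBy-comm s c d
  ... | false rewrite out-turnBy-opp s d | eq = refl

  endpointBy : Bool → State → Point
  endpointBy true  (w , d) = pt w ⊕ dirVec d
  endpointBy false (w , d) = pt w

  endpoint : State → Point
  endpoint e = endpointBy (isOut e) e

  endpoint-half-of : ∀ c P → endpoint (half-of c false P) ≡ β c (endpoint P)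
  endpoint-half-of c (q , d) with out d in eq
  ... | true rewrite out-opp-turnBy c d | eq =
    trans (β-⊕ plus (β c q) (δ c (dirVec d)))
      (trans (cong₂ _⊕_ (β-comm plus c q) (β-δ c (dirVec d))) (sym (β-⊕ c (pt q) (dirVec d))))
  ... | false rewrite eq = β-comm plus c q

  -- The turn predicted at the vertex z: odd vertices alternate with the sign c 0, even ones are
  -- vertices of the next level, and the origin, which belongs to all levels, gets ε.
  data Turn (c : ℕ → Sign) (z : Point) (s : Sign) : Set where
    t-zero : z ≡ O → s ≡ ε → Turn c z s
    t-odd  : parityP z ≡ minus → s ≡ c 0 · parityℤ (coord a z) → Turn c z s
    t-even : ∀ {z'} → z ≡ β (c 0) z' → Turn (tail c) z' s → Turn c z s

  Turn-odd-inv : ∀ {c z s} → parityP z ≡ minus → Turn c z s → s ≡ c 0 · parityℤ (coord a z)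
  Turn-odd-inv p (t-zero refl _)  = ⊥-elim (plus≢minus p)
  Turn-odd-inv p (t-odd _ q)      = q
  Turn-odd-inv {c} p (t-even {z'} refl _) = ⊥-elim (plus≢minus (trans (sym (parityP-β (c 0) z')) p))

  Turn-even-inv : ∀ {c z s} → Turn c (β (c 0) z) s → Turn (tail c) z s
  Turn-even-inv {c} (t-zero q r)  = t-zero (β-inj (c 0) (trans q (sym (β-O (c 0))))) r
  Turn-even-inv {c} {z} (t-odd p _) = ⊥-elim (plus≢minus (trans (sym (parityP-β (c 0) z)) p))
  Turn-even-inv {c} {z} {s} (t-even q t) = subst (λ z → Turn (tail c) z s) (β-inj (c 0) (sym q)) t

  Turn-O : ∀ {c z s} → z ≡ O → Turn c z s → s ≡ ε
  Turn-O q (t-zero _ r)    = r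
  Turn-O refl (t-odd p _)  = ⊥-elim (plus≢minus p)
  Turn-O {c} q (t-even r t) = Turn-O (β-inj (c 0) (trans (sym r) (trans q (sym (β-O (c 0)))))) t

  Turn-unique : ∀ {c z s s'} → Turn c z s → Turn c z s' → s ≡ s'
  Turn-unique (t-zero q r) t'     = trans r (sym (Turn-O q t'))
  Turn-unique (t-odd p r)  t'     = trans r (sym (Turn-odd-inv p t'))
  Turn-unique (t-even refl t) t'  = Turn-unique t (Turn-even-inv t')

  -- Division by 1 ± i halves the norm, so the descent through even vertices stops at an odd vertex
  -- or at the origin.
  Turn-total : ∀ n c z → norm z ℕ.≤ n → ∃[ s ] Turn c z s
  Turn-total zero c z p = ε , t-zero (nn≡0 z (ℕP.n≤0⇒n≡0 p)) refl
  Turn-total (suc n) c z p with parityP z in eq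
  ... | minus = _ , t-odd eq refl
  ... | plus  = let (s , t) = Turn-total n (tail c) (quo (c 0) z) h in s , t-even (sym (β-quo (c 0) z eq)) t
    where
    h : norm (quo (c 0) z) ℕ.≤ n
    h = halve-≤ (norm (quo (c 0) z)) (subst (ℕ._≤ suc n) (trans (cong norm (sym (β-quo (c 0) z eq))) (norm-β (c 0) (quo (c 0) z))) p)

  endpoint-out-odd : ∀ e → isOut e ≡ true → parityP (endpoint e) ≡ minus
  endpoint-out-odd (w , d) p rewrite p | parityP-⊕ (pt w) (dirVec d) | parityP-β plus w = parityP-dirVec d

  turn-out : ∀ {c s} e → isOut e ≡ true → Turn c (endpoint e) s → s ≡ c 0 · parityP (proj₁ e)
  turn-out {c} e@(w , d) p t =
    trans (Turn-odd-inv (endpoint-out-odd e p) t)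
          (cong (c 0 ·_) (trans (cong (λ b → parityℤ (coord a (endpointBy b e))) p) (parityℤ-coord a w d p)))

  turn-out-intro : ∀ {c s} e → isOut e ≡ true → s ≡ c 0 · parityP (proj₁ e) → Turn c (endpoint e) s
  turn-out-intro {c} e@(w , d) p q =
    t-odd (endpoint-out-odd e p)
      (trans q (cong (c 0 ·_) (sym (trans (cong (λ b → parityℤ (coord a (endpointBy b e))) p) (parityℤ-coord a w d p)))))

  parent-nx-out : ∀ c s e → isOut e ≡ true → s ≡ c · parityP (proj₁ e) → parent c (nx s e) ≡ parent c e
  parent-nx-out c s e p refl = trans (cong (parent c) q) (parent-half-of c false (parent c e))
    where
    k : half-of c true (parent c e) ≡ e
    k = trans (cong (λ b → half-of c b (parent c e)) (sym p)) (half-of-parent c e)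
    q : nx (c · parityP (proj₁ e)) e ≡ half-of c false (parent c e)
    q = subst (λ e' → nx (c · parityP (proj₁ e')) e' ≡ half-of c false (parent c e)) k (nx-half-of-out c (parent c e))

  half-of-in : ∀ c e → isOut e ≡ false → half-of c false (parent c e) ≡ e
  half-of-in c e p = trans (cong (λ b → half-of c b (parent c e)) (sym p)) (half-of-parent c e)

  parent-nx-in : ∀ c s e → isOut e ≡ false → parent c (nx s e) ≡ nx s (parent c e)
  parent-nx-in c s e p =
    trans (cong (parent c) (trans (cong (nx s) (sym (half-of-in c e p))) (nx-half-of-in c s (parent c e))))
          (parent-half-of c true (nx s (parent c e)))

  endpoint-parent : ∀ c e → isOut e ≡ false → endpoint e ≡ β c (endpoint (parent c e))
  endpoint-parent c e p = trans (cong endpoint (sym (half-of-in c e p))) (endpoint-half-of c (parent c e))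

  parityP-nx-out : ∀ s e → isOut e ≡ true → parityP (proj₁ (nx s e)) ≡ neg (parityP (proj₁ e))
  parityP-nx-out s (w , d) p rewrite p | parityP-⊕ w (δ s (dirVec d)) | parityP-δ s (dirVec d) | parityP-dirVec d = ·-minus (parityP w)

  parityP-nx-in : ∀ s e → isOut e ≡ false → proj₁ (nx s e) ≡ proj₁ e
  parityP-nx-in s (w , d) p rewrite p = refl

-- Level structure of two-sided folding sequences and their periods.

dbl-suc : ∀ h → ℤ.suc h + ℤ.suc h ≡ ℤ.suc (ℤ.suc (h + h))
dbl-suc = suc-dbl

∣dbl∣ : ∀ h → ℤ.∣ h + h ∣ ≡ ℤ.∣ h ∣ ℕ.+ ℤ.∣ h ∣
∣dbl∣ (+ n)     = refl
∣dbl∣ -[1+ n ]  = cong suc (sym (ℕP.+-suc n n))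

dblN : ℕ → ℤ → ℤ
dblN zero    k = k
dblN (suc n) k = dblN n k + dblN n k

evens : (ℤ → Sign) → ℤ → Sign
evens s k = s (k + k)

Div2 : ℕ → ℤ → Set
Div2 zero    m = ⊤
Div2 (suc n) m = Σ ℤ λ h → m ≡ h + h × Div2 n h

-- A period of a folding sequence is a multiple of 2ⁿ if it is respected on a window of this length.
window : ℕ → ℕ
window zero    = 0
window (suc n) = 6 ℕ.+ (window n ℕ.+ window n)

coord-⊕ : ∀ a u v → coord a (u ⊕ v) ≡ coord a u + coord a v
coord-⊕ horiz u v = refl
coord-⊕ vert  u v = refl

parityℤ-coord-β : ∀ a c u → parityℤ (coord a (β c u)) ≡ parityP u
parityℤ-coord-β vert  plus  (x , y) = parityℤ-x-y x y
parityℤ-coord-β horiz plus  (x , y) = refl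
parityℤ-coord-β vert  minus (x , y) = refl
parityℤ-coord-β horiz minus (x , y) = trans (parityℤ-x-y y x) (cong parityℤ (ℤP.+-comm y x))

module Hierarchy (ε : Sign) where

  -- The places 2ⁿ(2k+1) carry an alternating sequence whose value at k = 0 is `c n`. In this form,
  -- keeping only the even places just removes the first sign of `c`.
  record Hier (c : ℕ → Sign) (s : ℤ → Sign) : Set where
    field
      centre : s 0ℤ ≡ ε
      level  : ∀ n k → s (dblN n (ℤ.suc (k + k))) ≡ c n · parityℤ k

  open Hier public

  Hier-evens : ∀ {c s} → Hier c s → Hier (tail c) (evens s)
  Hier-evens H = record { centre = centre H ; level = λ n k → level H (suc n) k }

  odd-alt : ∀ {c s} → Hier c s → ∀ k → s (ℤ.suc (ℤ.suc k + ℤ.suc k)) ≡ neg (s (ℤ.suc (k + k)))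
  odd-alt {c} H k = trans (level H 0 (ℤ.suc k))
    (trans (cong (c 0 ·_) (parityℤ-suc k)) (trans (·-neg (c 0) (parityℤ k)) (cong neg (sym (level H 0 k)))))

  -- The places 2 and 6 are neighbours in the same alternating level, hence opposite, whereas two
  -- successive changes of sign would make them equal.
  even-not-alt : ∀ {c s} → Hier c s → s (+ 4) ≡ neg (s (+ 2)) → s (+ 6) ≡ neg (s (+ 4)) → ⊥
  even-not-alt {c} {s} H p q = neg≢ (trans (sym (odd-alt (Hier-evens H) 0ℤ)) (trans q (trans (cong neg p) (neg-neg (s (+ 2))))))

  -- An odd m would carry the places 2, 4, 6 to successive odd places, where the sequence
  -- alternates; hence the 6 in `window`. So m is even, and the even places pose the same problem
  -- for half of m, with a window of half the size.
  recognise : ∀ n {c s} → Hier c s → ∀ m → (∀ j → j ℕ.≤ window n → s (+ j + m) ≡ s (+ j)) → Div2 n m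
  recognise zero    H m f = tt
  recognise (suc n) {c} {s} H m f with parity m
  ... | od h = ⊥-elim (even-not-alt H
        (trans (sym (f 4 (ℕP.m≤m+n 4 _)))
          (trans (trans (cong s (e4 h)) (trans (odd-alt H (ℤ.suc h)) (cong (neg ∘ s) (sym (e2 h)))))
             (cong neg (f 2 (ℕP.m≤m+n 2 _)))))
        (trans (sym (f 6 (ℕP.m≤m+n 6 _)))
          (trans (trans (cong s (e6 h)) (trans (odd-alt H (ℤ.suc (ℤ.suc h))) (cong (neg ∘ s) (sym (e4 h)))))
             (cong neg (f 4 (ℕP.m≤m+n 4 _))))))
    where
    e2 : ∀ h → + 2 + (+ 1 + (h + h)) ≡ + 1 + (+ 1 + h + (+ 1 + h))
    e2 = solve-∀
    e4 : ∀ h → + 4 + (+ 1 + (h + h)) ≡ + 1 + (+ 1 + (+ 1 + h) + (+ 1 + (+ 1 + h)))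
    e4 = solve-∀
    e6 : ∀ h → + 6 + (+ 1 + (h + h)) ≡ + 1 + (+ 1 + (+ 1 + (+ 1 + h)) + (+ 1 + (+ 1 + (+ 1 + h))))
    e6 = solve-∀
  ... | ev h = h , refl , recognise n (Hier-evens H) h g
    where
    e : ∀ j h → j + h + (j + h) ≡ j + j + (h + h)
    e = solve-∀
    g : ∀ j → j ℕ.≤ window n → evens s (+ j + h) ≡ evens s (+ j)
    g j p = trans (cong s (e (+ j) h)) (f (j ℕ.+ j) (ℕP.m≤n⇒m≤o+n 6 (ℕP.+-mono-≤ p p)))

-- Paths that follow the predicted turns.

module Paths (a : Axis) (ε : Sign) where

  open Oriented a ε
  open Hierarchy ε

  Steps : (ℤ → Sign) → (ℤ → State) → Set
  Steps s X = ∀ k → X (ℤ.suc k) ≡ nx (s k) (X k)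

  Turns : (ℕ → Sign) → (ℤ → Sign) → (ℤ → State) → Set
  Turns c s X = ∀ k → Turn c (endpoint (X k)) (s k)

  -- When `X 0ℤ` is incoming and the odd turns are those of level 0, `X (2k-1)` and `X (2k)` are the
  -- two halves of one edge, so this lists the parents in order.
  derive : (ℕ → Sign) → (ℤ → State) → ℤ → State
  derive c X k = parent (c 0) (X (k + k))

  not-not : ∀ b → not (not b) ≡ b
  not-not true  = refl
  not-not false = refl

  module _ {s : ℤ → Sign} {X : ℤ → State} (st : Steps s X) where

    isOut-suc : ∀ k → isOut (X (ℤ.suc k)) ≡ not (isOut (X k))
    isOut-suc k = trans (cong isOut (st k)) (isOut-nx (s k) (X k))

    isOut-suc² : ∀ k → isOut (X (ℤ.suc (ℤ.suc k))) ≡ isOut (X k)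
    isOut-suc² k = trans (isOut-suc (ℤ.suc k)) (trans (cong not (isOut-suc k)) (not-not (isOut (X k))))

    isOut-even : ∀ k → isOut (X (k + k)) ≡ isOut (X 0ℤ)
    isOut-even = ℤ-ind _ refl
      (λ k ih → trans (cong (isOut ∘ X) (dbl-suc k)) (trans (isOut-suc² (k + k)) ih))
      (λ k ih → trans (sym (trans (cong (isOut ∘ X) (dbl-suc k)) (isOut-suc² (k + k)))) ih)

    isOut-odd : ∀ k → isOut (X (ℤ.suc (k + k))) ≡ not (isOut (X 0ℤ))
    isOut-odd k = trans (isOut-suc (k + k)) (cong not (isOut-even k))

    parityP-out-suc² : ∀ k → isOut (X k) ≡ true → parityP (proj₁ (X (ℤ.suc (ℤ.suc k)))) ≡ neg (parityP (proj₁ (X k)))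
    parityP-out-suc² k p = trans (cong (parityP ∘ proj₁) (st (ℤ.suc k)))
      (trans (cong parityP (parityP-nx-in (s (ℤ.suc k)) (X (ℤ.suc k)) (trans (isOut-suc k) (cong not p))))
        (trans (cong (parityP ∘ proj₁) (st k)) (parityP-nx-out (s k) (X k) p)))

    module Derive (c : ℕ → Sign) (inn : isOut (X 0ℤ) ≡ false)
                  (odd : ∀ k → s (ℤ.suc (k + k)) ≡ c 0 · parityP (proj₁ (X (ℤ.suc (k + k))))) where

      in-even : ∀ k → isOut (X (k + k)) ≡ false
      in-even k = trans (isOut-even k) inn

      out-odd : ∀ k → isOut (X (ℤ.suc (k + k))) ≡ true
      out-odd k = trans (isOut-odd k) (cong not inn)

      parent-odd : ∀ k → parent (c 0) (X (ℤ.suc (ℤ.suc (k + k)))) ≡ parent (c 0) (X (ℤ.suc (k + k)))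
      parent-odd k = trans (cong (parent (c 0)) (st (ℤ.suc (k + k))))
        (parent-nx-out (c 0) _ (X (ℤ.suc (k + k))) (out-odd k) (odd k))

      derive-suc : ∀ k → derive c X (ℤ.suc k) ≡ parent (c 0) (X (ℤ.suc (k + k)))
      derive-suc k = trans (cong (parent (c 0) ∘ X) (dbl-suc k)) (parent-odd k)

      derive-steps : Steps (evens s) (derive c X)
      derive-steps k = trans (derive-suc k)
        (trans (cong (parent (c 0)) (st (k + k))) (parent-nx-in (c 0) (s (k + k)) (X (k + k)) (in-even k)))

      endpoint-derive : ∀ k → endpoint (X (k + k)) ≡ β (c 0) (endpoint (derive c X k))
      endpoint-derive k = endpoint-parent (c 0) (X (k + k)) (in-even k)

      derive-turns : Turns c s X → Turns (tail c) (evens s) (derive c X)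
      derive-turns T k = Turn-even-inv (subst (λ z → Turn c z (s (k + k))) (endpoint-derive k) (T (k + k)))

  parent-O : ∀ c d → parent c (O , d) ≡ (O , d)
  parent-O plus  d = refl
  parent-O minus d = refl

  -- The path is pinned at index 1, not 0: the edge leaving the origin is its own parent, and in the
  -- derived path it again has index 1.
  record Central (d₁ : Dir) (c : ℕ → Sign) (s : ℤ → Sign) (X : ℤ → State) : Set where
    field
      hier   : Hier c s
      steps  : Steps s X
      begin  : X 1ℤ ≡ (O , d₁)
      begin-out : out d₁ ≡ true

    begin-in : isOut (X 0ℤ) ≡ false
    begin-in = trans (sym (not-not _)) (cong not (trans (sym (isOut-suc steps 0ℤ)) (trans (cong isOut begin) begin-out)))

    parityP-odd : ∀ k → parityP (proj₁ (X (ℤ.suc (k + k)))) ≡ parityℤ k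
    parityP-odd = ℤ-ind _ (cong (parityP ∘ proj₁) begin)
      (λ k ih → trans (e k) (trans (cong neg ih) (sym (parityℤ-suc k))))
      (λ k ih → trans (sym (neg-neg _)) (trans (cong neg (trans (sym (e k)) (trans ih (parityℤ-suc k)))) (neg-neg (parityℤ k))))
      where
      e : ∀ k → parityP (proj₁ (X (ℤ.suc (ℤ.suc k + ℤ.suc k)))) ≡ neg (parityP (proj₁ (X (ℤ.suc (k + k)))))
      e k = trans (cong (λ j → parityP (proj₁ (X (ℤ.suc j)))) (dbl-suc k))
              (parityP-out-suc² steps (ℤ.suc (k + k)) (trans (isOut-odd steps k) (cong not begin-in)))

    odd-turn : ∀ k → s (ℤ.suc (k + k)) ≡ c 0 · parityP (proj₁ (X (ℤ.suc (k + k))))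
    odd-turn k = trans (level hier 0 k) (cong (c 0 ·_) (sym (parityP-odd k)))

    open Derive steps c begin-in odd-turn public

    centre-O : endpoint (X 0ℤ) ≡ O
    centre-O rewrite begin-in = cong pt (trans (sym (parityP-nx-in (s 0ℤ) (X 0ℤ) begin-in)) (cong proj₁ (trans (sym (steps 0ℤ)) begin)))

  open Central

  Central-derive : ∀ {d₁ c s X} → Central d₁ c s X → Central d₁ (tail c) (evens s) (derive c X)
  Central-derive {d₁} {c} C = record
    { hier = Hier-evens (hier C) ; steps = derive-steps C
    ; begin = trans (parent-odd C 0ℤ) (trans (cong (parent (c 0)) (begin C)) (parent-O (c 0) d₁))
    ; begin-out = begin-out C }

  Central-turn : ∀ n k → ℤ.∣ k ∣ ℕ.≤ n → ∀ {d₁ c s X} → Central d₁ c s X → Turn c (endpoint (X k)) (s k)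
  Central-turn zero k p C with ℤP.∣i∣≡0⇒i≡0 {k} (ℕP.n≤0⇒n≡0 p)
  ... | refl = t-zero (centre-O C) (centre (hier C))
  Central-turn (suc n) k p C with parity k
  ... | od h = turn-out-intro _ (out-odd C h) (odd-turn C h)
  ... | ev h = t-even (endpoint-derive C h)
                 (Central-turn n h (halve-≤ ℤ.∣ h ∣ (subst (ℕ._≤ suc n) (∣dbl∣ h) p)) (Central-derive C))

  Central-turns : ∀ {d₁ c s X} → Central d₁ c s X → Turns c s X
  Central-turns C k = Central-turn _ k ℕP.≤-refl C

  depth : ∀ {c z s} → Turn c z s → ℕ
  depth (t-zero _ _)  = 0
  depth (t-odd _ _)   = 0
  depth (t-even _ t)  = suc (depth t)

  -- The first `depth T` factors 2 of m carry the translation down to the level where z becomes odd.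
  -- There one more factor makes the displacement even, and another makes its transverse coordinate
  -- even, so nothing in `t-odd` changes. The origin is never reduced to an odd vertex.
  Turn-shift : ∀ {d₁ c s X} → Central d₁ c s X → ∀ {z t} (T : Turn c z t) → ¬ z ≡ O →
               ∀ m → Div2 (2 ℕ.+ depth T) m → Turn c (z ⊕ endpoint (X m)) t
  Turn-shift C (t-zero q _) z≢O m D = ⊥-elim (z≢O q)
  Turn-shift {c = c} {X = X} C {z} (t-odd p q) z≢O m (h , refl , g , refl , tt) =
    t-odd (trans (parityP-⊕ z v) (cong₂ _·_ p (trans (cong parityP v≡) (parityP-β (c 0) _))))
      (trans q (cong (c 0 ·_) (sym (trans (cong parityℤ (coord-⊕ a z v)) (trans (parityℤ-+ (coord a z) (coord a v))
         (trans (cong (parityℤ (coord a z) ·_) ev-v) (·-plus _)))))))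
    where
    v = endpoint (X (g + g + (g + g)))
    Y = derive c X
    v≡ : v ≡ β (c 0) (endpoint (Y (g + g)))
    v≡ = endpoint-derive C (g + g)
    ev-v : parityℤ (coord a v) ≡ plus
    ev-v = trans (cong (parityℤ ∘ coord a) v≡) (trans (parityℤ-coord-β a (c 0) _)
             (trans (cong parityP (endpoint-derive (Central-derive C) g)) (parityP-β (c 1) _)))
  Turn-shift {c = c} {X = X} C {z} {t} (t-even {z'} q T) z≢O m (h , refl , D) =
    t-even (trans (cong₂ _⊕_ q (endpoint-derive C h)) (sym (β-⊕ (c 0) z' (endpoint (derive c X h)))))
      (Turn-shift (Central-derive C) T (λ e → z≢O (trans q (trans (cong (β (c 0)) e) (β-O (c 0))))) h D)

  -- Otherwise the even indices would be the outgoing edges, whose turns alternate, contrary to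
  -- `even-not-alt`.
  centre-in : ∀ {c s X} → Hier c s → Steps s X → Turns c s X → isOut (X 0ℤ) ≡ false
  centre-in {c} {s} {X} H st T with isOut (X 0ℤ) in eq
  ... | false = refl
  ... | true  = ⊥-elim (even-not-alt H (alt (+ 2) (isOut-even st 1ℤ)) (alt (+ 4) (isOut-even st (+ 2))))
    where
    turn-at : ∀ k → isOut (X k) ≡ isOut (X 0ℤ) → s k ≡ c 0 · parityP (proj₁ (X k))
    turn-at k p = turn-out (X k) (trans p eq) (T k)
    alt : ∀ k → isOut (X k) ≡ isOut (X 0ℤ) → s (ℤ.suc (ℤ.suc k)) ≡ neg (s k)
    alt k p = trans (turn-at (ℤ.suc (ℤ.suc k)) (trans (isOut-suc² st k) p))
      (trans (cong (c 0 ·_) (parityP-out-suc² st k (trans p eq)))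
        (trans (·-neg (c 0) _) (cong neg (sym (turn-at k p)))))

  -- The centre of the sequence is recognised at every level, so it lies in the intersection of all levels.
  centre-at-O : ∀ n {c s X} → Hier c s → Steps s X → Turns c s X → norm (endpoint (X 0ℤ)) ℕ.≤ n → endpoint (X 0ℤ) ≡ O
  centre-at-O zero    {X = X} H st T p = nn≡0 (endpoint (X 0ℤ)) (ℕP.n≤0⇒n≡0 p)
  centre-at-O (suc n) {c} {s} {X} H st T p =
    trans (D.endpoint-derive 0ℤ) (trans (cong (β (c 0)) (centre-at-O n (Hier-evens H) D.derive-steps (D.derive-turns T)
      (halve-≤ _ (subst (ℕ._≤ suc n) (trans (cong norm (D.endpoint-derive 0ℤ)) (norm-β (c 0) _)) p)))) (β-O (c 0)))
    where
    inn : isOut (X 0ℤ) ≡ false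
    inn = centre-in H st T
    module D = Derive st c inn (λ k → turn-out (X (ℤ.suc (k + k))) (trans (isOut-odd st k) (cong not inn)) (T (ℤ.suc (k + k))))

-- From ∞-folding sequences to the level structure.

applyUpTo-+ : ∀ {A : Set} (f : ℕ → A) m n → applyUpTo f (m ℕ.+ n) ≡ applyUpTo f m ++ applyUpTo (λ i → f (m ℕ.+ i)) n
applyUpTo-+ f zero    n = refl
applyUpTo-+ f (suc m) n = cong (f 0 ∷_) (applyUpTo-+ (f ∘ suc) m n)

++-split : ∀ {A : Set} (xs ys : List A) {us vs} → length xs ≡ length ys → xs ++ us ≡ ys ++ vs → xs ≡ ys × us ≡ vs
++-split []       []       _ q = refl , q
++-split (x ∷ xs) (y ∷ ys) l q with LP.∷-injective q
... | refl , q' = let (p , r) = ++-split xs ys (ℕP.suc-injective l) q' in cong (x ∷_) p , r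

applyDownFrom≡applyUpTo : ∀ {A : Set} (f g : ℕ → A) m → applyDownFrom f m ≡ applyUpTo g m →
                          ∀ i l → i ℕ.+ suc l ≡ m → f i ≡ g l
applyDownFrom≡applyUpTo f g (suc m) q i zero e =
  trans (cong f (ℕP.suc-injective (trans (sym (ℕP.+-comm i 1)) e))) (LP.∷-injectiveˡ q)
applyDownFrom≡applyUpTo f g (suc m) q i (suc l) e =
  applyDownFrom≡applyUpTo f (g ∘ suc) m (LP.∷-injectiveʳ q) i l (ℕP.suc-injective (trans (sym (ℕP.+-suc i (suc l))) e))
applyDownFrom≡applyUpTo f g zero q i l e with trans (sym (ℕP.+-suc i l)) e
... | ()

length-bar : ∀ L → length (bar L) ≡ length L
length-bar L = trans (LP.length-reverse (map neg L)) (LP.length-map neg L)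

length-Folding : ∀ {n L} → Folding n L → suc (length L) ≡ 2 ℕ.^ n
length-Folding fold0 = refl
length-Folding {suc n} (foldS {S = L} F x) =
  trans (cong suc (trans (LP.length-++ (bar L)) (cong (ℕ._+ suc (length L)) (length-bar L))))
    (cong₂ ℕ._+_ (length-Folding F) (trans (length-Folding F) (sym (ℕP.+-identityʳ (2 ℕ.^ n)))))

-- Antisymmetry about the place 2ⁿ for sequences numbered from 1: `suc l` is the mirror image of 2ⁿ
-- + `suc i`, and the successors exclude the centre and the place 0.
Mirror : (ℕ → Sign) → Set
Mirror A = ∀ n i l → suc i ℕ.+ suc l ≡ 2 ℕ.^ n → A (2 ℕ.^ n ℕ.+ suc i) ≡ neg (A (suc l))

-- The prefix of length 2^(n+1) - 1 has its middle at place 2ⁿ, and the two sides of a folding have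
-- equal length, so they can be compared with the prefix entry by entry.
mirror : ∀ R → InfFolding R → Mirror (R ∘ ℕ.pred)
mirror R inf n i l e = go (inf n) refl
  where
  go : ∀ {L} → Folding (suc n) L → L ≡ applyUpTo R (2 ℕ.^ suc n ℕ.∸ 1) → R (ℕ.pred (2 ℕ.^ n ℕ.+ suc i)) ≡ neg (R l)
  go (foldS {S = T} F x) q = trans (sym (neg-neg _)) (cong neg (trans (cong (λ k → neg (R k)) idx) el))
    where
    m = length T
    sm : suc m ≡ 2 ℕ.^ n
    sm = length-Folding F
    len : 2 ℕ.^ suc n ℕ.∸ 1 ≡ m ℕ.+ suc m
    len = cong (ℕ._∸ 1) (trans (cong (2 ℕ.^ n ℕ.+_) (ℕP.+-identityʳ (2 ℕ.^ n))) (sym (cong₂ ℕ._+_ sm sm)))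
    g : ℕ → Sign
    g i = R (m ℕ.+ suc i)
    q' : bar T ++ x ∷ T ≡ applyUpTo R m ++ R (m ℕ.+ 0) ∷ applyUpTo g m
    q' = trans q (trans (cong (applyUpTo R) len) (applyUpTo-+ R m (suc m)))
    sp = ++-split (bar T) (applyUpTo R m) (trans (length-bar T) (sym (LP.length-applyUpTo R m))) q'
    T≡ : T ≡ applyUpTo g m
    T≡ = LP.∷-injectiveʳ (proj₂ sp)
    dn : applyDownFrom (neg ∘ g) m ≡ applyUpTo R m
    dn = trans (sym (LP.reverse-applyUpTo (neg ∘ g) m))
           (trans (cong reverse (sym (LP.map-applyUpTo g neg m)))
             (trans (cong (reverse ∘ map neg) (sym T≡)) (proj₁ sp)))
    el : neg (g i) ≡ R l
    el = applyDownFrom≡applyUpTo (neg ∘ g) R m dn i l (ℕP.suc-injective (trans e (sym sm)))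
    idx : ℕ.pred (2 ℕ.^ n ℕ.+ suc i) ≡ m ℕ.+ suc i
    idx = cong (λ k → ℕ.pred (k ℕ.+ suc i)) (sym sm)

Mirror-evens : ∀ A → Mirror A → Mirror (λ k → A (k ℕ.+ k))
Mirror-evens A M n i l e =
  trans (cong A (e1 (2 ℕ.^ n) i)) (M (suc n) (i ℕ.+ suc i) (l ℕ.+ suc l) e2)
  where
  e1 : ∀ p i → p ℕ.+ suc i ℕ.+ (p ℕ.+ suc i) ≡ p ℕ.+ (p ℕ.+ 0) ℕ.+ (suc (i ℕ.+ suc i))
  e1 = nsolve
  e3 : ∀ i l → suc (i ℕ.+ suc i) ℕ.+ suc (l ℕ.+ suc l) ≡ (suc i ℕ.+ suc l) ℕ.+ (suc i ℕ.+ suc l ℕ.+ 0)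
  e3 = nsolve
  e2 : suc (i ℕ.+ suc i) ℕ.+ suc (l ℕ.+ suc l) ≡ 2 ℕ.^ suc n
  e2 = trans (e3 i l) (cong (λ p → p ℕ.+ (p ℕ.+ 0)) e)

n<2^n : ∀ n → n ℕ.< 2 ℕ.^ n
n<2^n zero    = ℕ.s≤s ℕ.z≤n
n<2^n (suc n) = ℕP.≤-trans (ℕP.+-mono-≤ (ℕP.≤-trans (ℕ.s≤s ℕ.z≤n) (n<2^n n)) (n<2^n n))
                           (ℕP.≤-reflexive (cong (2 ℕ.^ n ℕ.+_) (sym (ℕP.+-identityʳ (2 ℕ.^ n)))))

altSign-+dbl : ∀ j k → altSign (j ℕ.+ k ℕ.+ j) ≡ altSign k
altSign-+dbl zero    k = cong altSign (ℕP.+-identityʳ k)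
altSign-+dbl (suc j) k = trans (cong (altSign ∘ suc) (ℕP.+-suc (j ℕ.+ k) j)) (trans (neg-neg _) (altSign-+dbl j k))

-- Reflection about 2^(n+1) sends 2k+1 to 2k'+1 with k + k' odd, so its change of sign agrees with
-- the alternation. The bound on k only serves the induction.
Mirror-odd : ∀ A → Mirror A → ∀ n k → suc (k ℕ.+ k) ℕ.< 2 ℕ.^ suc n → A (suc (k ℕ.+ k)) ≡ A 1 · altSign k
Mirror-odd A M zero zero p = sym (·-plus (A 1))
Mirror-odd A M zero (suc k) (ℕ.s≤s (ℕ.s≤s ()))
Mirror-odd A M (suc n) k p with 2 ℕ.^ n ℕ.≤? k
... | no  k≱ = Mirror-odd A M n k (ℕP.≤-trans (ℕ.s≤s (ℕP.≤-reflexive (sym (ℕP.+-suc k k))))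
       (ℕP.≤-trans (ℕP.+-mono-≤ (ℕP.≰⇒> k≱) (ℕP.≰⇒> k≱)) (ℕP.≤-reflexive (cong (2 ℕ.^ n ℕ.+_) (sym (ℕP.+-identityʳ _))))))
... | yes k≥ = result (Mirror-odd A M n)
  where
  P = 2 ℕ.^ n
  j = k ℕ.∸ P
  k≡ : k ≡ P ℕ.+ j
  k≡ = sym (ℕP.m+[n∸m]≡n k≥)
  dbl-lt : ∀ {x y} → suc (x ℕ.+ x) ℕ.< y ℕ.+ y → x ℕ.< y
  dbl-lt {x} {y} q with suc x ℕ.≤? y
  ... | yes r = r
  ... | no  r = ⊥-elim (ℕP.<⇒≱ q (ℕP.m≤n⇒m≤1+n (ℕP.+-mono-≤ (ℕP.≮⇒≥ r) (ℕP.≮⇒≥ r))))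
  e0 : ∀ P → 2 ℕ.* (2 ℕ.* P) ≡ (P ℕ.+ P) ℕ.+ (P ℕ.+ P)
  e0 = nsolve
  k<2P : k ℕ.< P ℕ.+ P
  k<2P = dbl-lt (subst (suc (k ℕ.+ k) ℕ.<_) (e0 P) p)
  j<P : j ℕ.< P
  j<P = ℕP.+-cancelˡ-< P j P (subst (ℕ._< P ℕ.+ P) k≡ k<2P)
  k' = P ℕ.∸ suc j
  P≡ : P ≡ suc (j ℕ.+ k')
  P≡ = sym (ℕP.m+[n∸m]≡n j<P)
  lt : suc (k' ℕ.+ k') ℕ.< 2 ℕ.^ suc n
  lt = subst₂ ℕ._≤_ (ℕP.+-suc (suc k') k') (cong (P ℕ.+_) (sym (ℕP.+-identityʳ P)))
         (ℕP.+-mono-≤ k'<P k'<P)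
    where
    k'<P : k' ℕ.< P
    k'<P = subst (suc k' ℕ.≤_) (sym P≡) (ℕ.s≤s (ℕP.m≤n+m k' j))
  e1 : ∀ P j → suc ((P ℕ.+ j) ℕ.+ (P ℕ.+ j)) ≡ 2 ℕ.* P ℕ.+ suc (j ℕ.+ j)
  e1 = nsolve
  e2 : ∀ j k → suc (j ℕ.+ j) ℕ.+ suc (k ℕ.+ k) ≡ 2 ℕ.* suc (j ℕ.+ k)
  e2 = nsolve
  result : (∀ k → suc (k ℕ.+ k) ℕ.< 2 ℕ.^ suc n → A (suc (k ℕ.+ k)) ≡ A 1 · altSign k) → A (suc (k ℕ.+ k)) ≡ A 1 · altSign k
  result ih = trans (cong A (trans (cong (λ k → suc (k ℕ.+ k)) k≡) (e1 P j)))
    (trans (M (suc n) (j ℕ.+ j) (k' ℕ.+ k') (trans (e2 j k') (cong (2 ℕ.*_) (sym P≡))))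
      (trans (cong neg (ih k' lt))
        (trans (sym (·-neg (A 1) (altSign k')))
          (cong (A 1 ·_) (sym (trans (cong altSign (trans k≡ (cong (ℕ._+ j) P≡))) (cong neg (altSign-+dbl j k'))))))))

module _ (ε : Sign) where
  open Hierarchy ε

  twoSidedA : (ℕ → Sign) → ℤ → Sign
  twoSidedA A = twoSided (A ∘ suc) ε

  twoSidedA-evens : ∀ A k → twoSidedA A (k + k) ≡ twoSidedA (λ k → A (k ℕ.+ k)) k
  twoSidedA-evens A (+ zero)   = refl
  twoSidedA-evens A (+ suc h)  = refl
  twoSidedA-evens A -[1+ h ]   = cong (λ k → neg (A (suc k))) (sym (ℕP.+-suc h h))

  twoSidedA-level : ∀ n A → Mirror A → ∀ k → twoSidedA A (dblN n (ℤ.suc (k + k))) ≡ A (2 ℕ.^ n) · parityℤ k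
  twoSidedA-level zero A M (+ h) = Mirror-odd A M (h ℕ.+ h) h (n<2^n (suc (h ℕ.+ h)))
  twoSidedA-level zero A M -[1+ h ] =
    trans (cong neg (Mirror-odd A M (h ℕ.+ h) h (n<2^n (suc (h ℕ.+ h))))) (sym (·-neg (A 1) (altSign h)))
  twoSidedA-level (suc n) A M k =
    trans (twoSidedA-evens A (dblN n (ℤ.suc (k + k))))
      (trans (twoSidedA-level n (λ k → A (k ℕ.+ k)) (Mirror-evens A M) k)
        (cong (λ m → A (2 ℕ.^ n ℕ.+ m) · parityℤ k) (sym (ℕP.+-identityʳ (2 ℕ.^ n)))))

  twoSided-Hier : ∀ R → InfFolding R → Hier (λ n → R (2 ℕ.^ n ℕ.∸ 1)) (twoSided R ε)
  twoSided-Hier R inf = record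
    { centre = refl
    ; level = λ n → twoSidedA-level n (R ∘ ℕ.pred) (mirror R inf) }

-- Ancestors, and their behaviour under translations and rotations.

code : Dir → ℕ
code E = 0
code N = 1
code W = 2
code S = 3

decode : ℕ → Dir
decode 0 = E
decode 1 = N
decode 2 = W
decode _ = S

decode-code : ∀ d → decode (code d) ≡ d
decode-code E = refl
decode-code N = refl
decode-code W = refl
decode-code S = refl

_≟D_ : (d d' : Dir) → Dec (d ≡ d')
d ≟D d' = map′ (λ q → trans (sym (decode-code d)) (trans (cong decode q) (decode-code d'))) (cong code) (code d ℕ.≟ code d')

_≟P_ : (u v : Point) → Dec (u ≡ v)
_≟P_ = ×P.≡-dec ℤ._≟_ ℤ._≟_

_≟St_ : (e f : State) → Dec (e ≡ f)
_≟St_ = ×P.≡-dec _≟P_ _≟D_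

-- Signs are taken from a finite word so that statements about all words of a given length can be
-- decided by evaluation.
ancestorV : ∀ {k} → Vec Sign k → State → State
ancestorV []       e = e
ancestorV (c ∷ cs) e = ancestorV cs (parent c e)

prefix : (ℕ → Sign) → (k : ℕ) → Vec Sign k
prefix c zero    = []
prefix c (suc k) = c 0 ∷ prefix (tail c) k

ancestor : (ℕ → Sign) → ℕ → State → State
ancestor c k = ancestorV (prefix c k)

from : (ℕ → Sign) → ℕ → ℕ → Sign
from c m k = c (m ℕ.+ k)

ancestor-+ : ∀ c m n e → ancestor c (m ℕ.+ n) e ≡ ancestor (from c m) n (ancestor c m e)
ancestor-+ c zero    n e = refl
ancestor-+ c (suc m) n e = ancestor-+ (tail c) m n (parent (c 0) e)

∀-words? : ∀ k {P : Vec Sign k → Set} → (∀ v → Dec (P v)) → Dec (∀ v → P v)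
∀-words? zero    P? = map′ (λ { p [] → p }) (λ f → f []) (P? [])
∀-words? (suc k) P? =
  map′ (λ { (p , q) (plus ∷ v) → p v ; (p , q) (minus ∷ v) → q v }) (λ f → (λ v → f (plus ∷ v)) , (λ v → f (minus ∷ v)))
    (∀-words? k (λ v → P? (plus ∷ v)) ×-dec ∀-words? k (λ v → P? (minus ∷ v)))

infixl 20 _⊞_
_⊞_ : State → Point → State
(w , d) ⊞ t = (w ⊕ t , d)

parent-⊞ : ∀ c e t → parent c (e ⊞ β c t) ≡ parent c e ⊞ t
parent-⊞ c e t with parent-view c e
... | inj₁ q = trans (cong (λ e → parent c (e ⊞ β c t)) q)
    (trans (cong (λ u → parent c (u , proj₂ (parent c e))) (sym (β-⊕ c (proj₁ (parent c e)) t))) (parent-nearHalf c (parent c e ⊞ t)))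
... | inj₂ q = trans (cong (λ e → parent c (e ⊞ β c t)) q)
    (trans (cong (λ u → parent c (u , opp (turnBy c d))) (trans (swap (β c w) (δ c (dirVec d)) (β c t)) (cong (_⊕ δ c (dirVec d)) (sym (β-⊕ c w t)))))
           (parent-farHalf c (parent c e ⊞ t)))
  where
  w = proj₁ (parent c e)
  d = proj₂ (parent c e)
  swap : ∀ x y z → (x ⊕ y) ⊕ z ≡ (x ⊕ z) ⊕ y
  swap x y z = trans (⊕-assoc x y z) (trans (cong (x ⊕_) (⊕-comm y z)) (sym (⊕-assoc x z y)))

βV : ∀ {k} → Vec Sign k → Point → Point
βV []       t = t
βV (c ∷ cs) t = β c (βV cs t)

ancestorV-⊞ : ∀ {k} (cs : Vec Sign k) e t → ancestorV cs (e ⊞ βV cs t) ≡ ancestorV cs e ⊞ t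
ancestorV-⊞ []       e t = refl
ancestorV-⊞ (c ∷ cs) e t = trans (cong (ancestorV cs) (parent-⊞ c e (βV cs t))) (ancestorV-⊞ cs (parent c e) t)

rotSt : State → State
rotSt (w , d) = (rotate plus w , left d)

rot-β : ∀ c w → rotate plus (β c w) ≡ β c (rotate plus w)
rot-β plus (x , y) = p≡ (l1 x y) (l2 x y)
  where
  l1 : ∀ x y → - (x + y) ≡ - y - x
  l1 = solve-∀
  l2 : ∀ x y → x - y ≡ - y + x
  l2 = solve-∀
rot-β minus (x , y) = p≡ (l1 x y) (l2 x y)
  where
  l1 : ∀ x y → - (y - x) ≡ - y + x
  l1 = solve-∀
  l2 : ∀ x y → x + y ≡ x - - y
  l2 = solve-∀

rot-δ : ∀ c v → rotate plus (δ c v) ≡ δ c (rotate plus v)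
rot-δ plus  v       = refl
rot-δ minus (x , y) = p≡ (ℤP.neg-involutive x) (sym (ℤP.neg-involutive y))

rot-⊕ : ∀ u v → rotate plus (u ⊕ v) ≡ rotate plus u ⊕ rotate plus v
rot-⊕ (a , b) (x , y) = p≡ (ℤP.neg-distrib-+ b y) refl

parent-rot : ∀ c e → parent c (rotSt e) ≡ rotSt (parent c e)
parent-rot c e with parent-view c e
... | inj₁ q = trans (cong (parent c ∘ rotSt) q)
    (trans (cong (λ u → parent c (u , left (proj₂ (parent c e)))) (rot-β c (proj₁ (parent c e)))) (parent-nearHalf c (rotSt (parent c e))))
... | inj₂ q = trans (cong (parent c ∘ rotSt) q)
    (trans (cong (parent c) (cong₂ _,_ e1 e2)) (parent-farHalf c (rotSt (parent c e))))
  where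
  w = proj₁ (parent c e)
  d = proj₂ (parent c e)
  e1 : rotate plus (β c w ⊕ δ c (dirVec d)) ≡ β c (rotate plus w) ⊕ δ c (dirVec (left d))
  e1 = trans (rot-⊕ (β c w) (δ c (dirVec d)))
         (cong₂ _⊕_ (rot-β c w) (trans (rot-δ c (dirVec d)) (cong (δ c) (sym (dirVec-turnBy plus d)))))
  e2 : left (opp (turnBy c d)) ≡ opp (turnBy c (left d))
  e2 = trans (turnBy-opp plus (turnBy c d)) (cong opp (turnBy-comm plus c d))

ancestorV-rot : ∀ {k} (cs : Vec Sign k) e → ancestorV cs (rotSt e) ≡ rotSt (ancestorV cs e)
ancestorV-rot []       e = refl
ancestorV-rot (c ∷ cs) e = trans (cong (ancestorV cs) (parent-rot c e)) (ancestorV-rot cs (parent c e))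

-- Contraction towards a finite attractor

norm-dirVec : ∀ d → norm (dirVec d) ≡ 1
norm-dirVec E = refl
norm-dirVec N = refl
norm-dirVec W = refl
norm-dirVec S = refl

norm-δ : ∀ c v → norm (δ c v) ≡ norm v
norm-δ plus  v       = refl
norm-δ minus (x , y) = trans (cong (λ k → ℤ.∣ y ∣ ℕ.* ℤ.∣ y ∣ ℕ.+ k ℕ.* k) (ℤP.∣-i∣≡∣i∣ x)) (ℕP.+-comm (ℤ.∣ y ∣ ℕ.* ℤ.∣ y ∣) _)

-- 5|u+v|² + 20|v|² = 4|u|² + |u+5v|²; the last term is dropped to get a linear bound.
norm-split : ∀ u v → 5 ℕ.* norm (u ⊕ v) ℕ.+ 20 ℕ.* norm v
         ≡ 4 ℕ.* norm u ℕ.+ norm (proj₁ u + + 5 * proj₁ v , proj₂ u + + 5 * proj₂ v)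
norm-split u@(x , y) v@(a , b) = ℤP.+-injective (trans lhs (trans (l x y a b) (sym rhs)))
  where
  +* : ∀ k z → + (k ℕ.* norm z) ≡ + k * (proj₁ z * proj₁ z + proj₂ z * proj₂ z)
  +* k z = trans (ℤP.pos-* k (norm z)) (cong (+ k *_) (+nn z))
  lhs : + (5 ℕ.* norm (u ⊕ v) ℕ.+ 20 ℕ.* norm v) ≡ + 5 * ((x + a) * (x + a) + (y + b) * (y + b)) + + 20 * (a * a + b * b)
  lhs = cong₂ _+_ (+* 5 (u ⊕ v)) (+* 20 v)
  rhs : + (4 ℕ.* norm u ℕ.+ norm (x + + 5 * a , y + + 5 * b))
      ≡ + 4 * (x * x + y * y) + ((x + + 5 * a) * (x + + 5 * a) + (y + + 5 * b) * (y + + 5 * b))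
  rhs = cong₂ _+_ (+* 4 u) (+nn (x + + 5 * a , y + + 5 * b))
  l : ∀ x y a b → + 5 * ((x + a) * (x + a) + (y + b) * (y + b)) + + 20 * (a * a + b * b)
    ≡ + 4 * (x * x + y * y) + ((x + + 5 * a) * (x + + 5 * a) + (y + + 5 * b) * (y + + 5 * b))
  l = solve-∀

8*≡4*dbl : ∀ n → 8 ℕ.* n ≡ 4 ℕ.* (n ℕ.+ n)
8*≡4*dbl n = trans (ℕP.*-assoc 4 2 n) (cong (λ k → 4 ℕ.* (n ℕ.+ k)) (ℕP.+-identityʳ n))

-- An affine contraction with fixed point 20/3: integer norms above 6 strictly decrease, which is
-- where the constant 6 comes from.
norm-parent : ∀ c e → 8 ℕ.* norm (proj₁ (parent c e)) ℕ.≤ 5 ℕ.* norm (proj₁ e) ℕ.+ 20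
norm-parent c e with parent-view c e
... | inj₁ q = ℕP.≤-trans (ℕP.≤-reflexive (trans (8*≡4*dbl (norm w)) (cong (4 ℕ.*_) (trans (sym (norm-β c w)) (cong (norm ∘ proj₁) (sym q))))))
                 (ℕP.m≤n⇒m≤n+o 20 (ℕP.*-monoˡ-≤ (norm (proj₁ e)) (ℕP.m≤n+m 4 1)))
  where w = proj₁ (parent c e)
... | inj₂ q = ℕP.≤-trans (ℕP.≤-reflexive (trans (8*≡4*dbl (norm w)) (cong (4 ℕ.*_) (sym (norm-β c w)))))
                 (ℕP.≤-trans (ℕP.m≤m+n (4 ℕ.* norm (β c w)) _)
                   (ℕP.≤-reflexive (trans (sym (norm-split (β c w) v))
                     (cong₂ (λ m n → 5 ℕ.* m ℕ.+ 20 ℕ.* n) (cong (norm ∘ proj₁) (sym q)) (trans (norm-δ c (dirVec d)) (norm-dirVec d))))))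
  where
  w = proj₁ (parent c e)
  d = proj₂ (parent c e)
  v = δ c (dirVec d)

-- Each level lowers the bound by one, since 5(n+7) + 20 < 8(n+7).
ancestor-zone : ∀ n c e → norm (proj₁ e) ℕ.≤ n ℕ.+ 6 → norm (proj₁ (ancestor c n e)) ℕ.≤ 6
ancestor-zone zero    c e p = p
ancestor-zone (suc n) c e p = ancestor-zone n (tail c) (parent (c 0) e) (ℕ.s≤s⁻¹ (ℕP.*-cancelˡ-< 8 q (suc (n ℕ.+ 6)) lt))
  where
  q = norm (proj₁ (parent (c 0) e))
  e1 : ∀ n → 5 ℕ.* (1 ℕ.+ (n ℕ.+ 6)) ℕ.+ 20 ℕ.+ 1 ℕ.+ 3 ℕ.* n ≡ 8 ℕ.* (1 ℕ.+ (n ℕ.+ 6))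
  e1 = nsolve
  lt : 8 ℕ.* q ℕ.< 8 ℕ.* suc (n ℕ.+ 6)
  lt = ℕP.≤-trans (ℕP.≤-trans (ℕ.s≤s (ℕP.≤-trans (norm-parent (c 0) e) (ℕP.+-monoˡ-≤ 20 (ℕP.*-monoʳ-≤ 5 p))))
         (ℕP.≤-reflexive (ℕP.+-comm 1 _)))
         (ℕP.≤-trans (ℕP.m≤m+n _ (3 ℕ.* n)) (ℕP.≤-reflexive (e1 n)))

-- Every edge ends up here: the edges at the origin are fixed by both parent maps, while kA survives
-- only the sign plus (becoming kB) and kB only minus (becoming kA).
data Kind : State → Set where
  kO : ∀ d → Kind (O , d)
  kA : ∀ d → Kind (⊝ dirVec d , d)
  kB : ∀ d → Kind (⊝ dirVec d , left d)

dirs : List Dir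
dirs = E ∷ N ∷ W ∷ S ∷ []

kinds : List (Σ State Kind)
kinds = (_ , kO E) ∷ (_ , kO N) ∷ (_ , kO W) ∷ (_ , kO S)
      ∷ (_ , kA E) ∷ (_ , kA N) ∷ (_ , kA W) ∷ (_ , kA S)
      ∷ (_ , kB E) ∷ (_ , kB N) ∷ (_ , kB W) ∷ (_ , kB S) ∷ []

InK : State → Set
InK e = Any (λ k → e ≡ proj₁ k) kinds

inK? : ∀ e → Dec (InK e)
inK? e = Any.any? (λ k → e ≟St proj₁ k) kinds

InK⇒Kind : ∀ {e} → InK e → Kind e
InK⇒Kind p = go kinds p
  where
  go : ∀ {e} ks → Any (λ k → e ≡ proj₁ k) ks → Kind e
  go (k ∷ ks) (here q)  = subst Kind (sym q) (proj₂ k)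
  go (k ∷ ks) (there p) = go ks p

ints : List ℤ
ints = + 0 ∷ + 1 ∷ + 2 ∷ -[1+ 0 ] ∷ -[1+ 1 ] ∷ []

sq-small : ∀ x → ℤ.∣ x ∣ ℕ.* ℤ.∣ x ∣ ℕ.≤ 6 → Any (x ≡_) ints
sq-small (+ 0) _ = here refl
sq-small (+ 1) _ = there (here refl)
sq-small (+ 2) _ = there (there (here refl))
sq-small (+ suc (suc (suc n))) p = ⊥-elim (ℕP.<⇒≱ (ℕP.≤-trans (ℕP.m≤m+n 7 2) (ℕP.*-mono-≤ (ℕP.m≤m+n 3 n) (ℕP.m≤m+n 3 n))) p)
sq-small -[1+ 0 ] _ = there (there (there (here refl)))
sq-small -[1+ 1 ] _ = there (there (there (there (here refl))))
sq-small -[1+ suc (suc n) ] p = ⊥-elim (ℕP.<⇒≱ (ℕP.≤-trans (ℕP.m≤m+n 7 2) (ℕP.*-mono-≤ (ℕP.m≤m+n 3 n) (ℕP.m≤m+n 3 n))) p)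

dir-any : ∀ d → Any (d ≡_) dirs
dir-any E = here refl
dir-any N = there (here refl)
dir-any W = there (there (here refl))
dir-any S = there (there (there (here refl)))

lookupAll : ∀ {A : Set} {P : A → Set} {xs} → All P xs → ∀ {x} → Any (x ≡_) xs → P x
lookupAll {P = P} (p ∷ _) (here q)   = subst P (sym q) p
lookupAll (_ ∷ qs) (there q) = lookupAll qs q

abstract
  -- A computation over 100 states and 32 words. The square of side five contains all bases of norm
  -- at most 6, and five levels bring the whole square into the attractor whatever the signs.
  zone-check : All (λ x → All (λ y → All (λ d → ∀ v → InK (ancestorV {5} v ((x , y) , d))) dirs) ints) ints
  zone-check = toWitness {a? = All.all? (λ x → All.all? (λ y → All.all? (λ d → ∀-words? 5 (λ v → inK? (ancestorV v ((x , y) , d)))) dirs) ints) ints} tt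

zone⇒Kind : ∀ c e → norm (proj₁ e) ℕ.≤ 6 → Kind (ancestor c 5 e)
zone⇒Kind c ((x , y) , d) p = InK⇒Kind (lookupAll (lookupAll (lookupAll zone-check
  (sq-small x (ℕP.≤-trans (ℕP.m≤m+n _ _) p))) (sq-small y (ℕP.≤-trans (ℕP.m≤n+m _ (ℤ.∣ x ∣ ℕ.* ℤ.∣ x ∣)) p))) (dir-any d) (prefix c 5))

ancestor-Kind : ∀ n c e → norm (proj₁ e) ℕ.≤ n ℕ.+ 6 → Kind (ancestor c (n ℕ.+ 5) e)
ancestor-Kind n c e p = subst Kind (sym (ancestor-+ c n 5 e)) (zone⇒Kind (from c n) (ancestor c n e) (ancestor-zone n c e p))

-- Large disks on a single curve.

place : ∀ {k} → Vec Sign k → Vec Bool k → Point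
place cs bs = proj₁ (go cs bs)
  where
  go : ∀ {k} → Vec Sign k → Vec Bool k → State
  go []       []       = (O , N)
  -- The last entry of the address makes the choice closest to the ancestor (`O`, `N`).
  go (c ∷ cs) (b ∷ bs) = Oriented.pick vert plus b c (go cs bs)

-- Found by computer search: for each word of seven signs, one of these positions is deep inside the
-- piece of curve spanned by a single edge of level seven.
addresses : List (Vec Bool 7)
addresses = (false ∷ false ∷ true ∷ false ∷ false ∷ true ∷ false ∷ [])
          ∷ (false ∷ false ∷ true ∷ false ∷ true  ∷ true ∷ false ∷ [])
          ∷ (false ∷ true ∷ false ∷ false ∷ true ∷ false ∷ false ∷ [])
          ∷ (false ∷ true ∷ false ∷ true  ∷ true ∷ false ∷ false ∷ []) ∷ []

abstract
  interior-check : ∀ (v : Vec Sign 7) → Any (λ bs → All (λ k → ancestorV v (proj₁ k ⊞ place v bs) ≡ (O , N)) kinds) addresses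
  interior-check = toWitness {a? = ∀-words? 7 (λ v → Any.any? (λ bs → All.all? (λ k → ancestorV v (proj₁ k ⊞ place v bs) ≟St (O , N)) kinds) addresses)} tt

-- Plays the part of an interior point: any disk contracts into a translate of the attractor, so it
-- is enough that one whole translate merges into a single edge.
Interior : Dir → Set
Interior d = ∀ (v : Vec Sign 7) → ∃[ τ ] (∀ e → Kind e → ancestorV v (e ⊞ τ) ≡ (O , d))

All⇒Kind : ∀ {P : State → Set} → All (λ k → P (proj₁ k)) kinds → ∀ {e} → Kind e → P e
All⇒Kind (oE ∷ oN ∷ oW ∷ oS ∷ aE ∷ aN ∷ aW ∷ aS ∷ bE ∷ bN ∷ bW ∷ bS ∷ []) = λ where
  (kO E) → oE
  (kO N) → oN
  (kO W) → oW
  (kO S) → oS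
  (kA E) → aE
  (kA N) → aN
  (kA W) → aW
  (kA S) → aS
  (kB E) → bE
  (kB N) → bN
  (kB W) → bW
  (kB S) → bS

interior-N : Interior N
interior-N v = place v (proj₁ good) , λ e k → All⇒Kind {λ e → ancestorV v (e ⊞ place v (proj₁ good)) ≡ (O , N)} (proj₂ good) k
  where good = Any.satisfied (interior-check v)

unrotate : ∀ {e} → Kind e → ∃[ e' ] (Kind e' × rotSt e' ≡ e)
unrotate (kO E) = _ , kO S , refl
unrotate (kO N) = _ , kO E , refl
unrotate (kO W) = _ , kO N , refl
unrotate (kO S) = _ , kO W , refl
unrotate (kA E) = _ , kA S , refl
unrotate (kA N) = _ , kA E , refl
unrotate (kA W) = _ , kA N , refl
unrotate (kA S) = _ , kA W , refl
unrotate (kB E) = _ , kB S , refl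
unrotate (kB N) = _ , kB E , refl
unrotate (kB W) = _ , kB N , refl
unrotate (kB S) = _ , kB W , refl

interior-left : ∀ {d} → Interior d → Interior (left d)
interior-left {d} int v with int v
... | τ , f = rotate plus τ , g
  where
  g : ∀ e → Kind e → ancestorV v (e ⊞ rotate plus τ) ≡ (O , left d)
  g e k with unrotate k
  ... | e' , k' , refl = trans (cong (λ w → ancestorV v (w , left (proj₂ e'))) (sym (rot-⊕ (proj₁ e') τ)))
                           (trans (ancestorV-rot v (e' ⊞ τ)) (cong rotSt (f e' k')))

interior : ∀ d → Interior d
interior N = interior-N
interior W = interior-left {N} interior-N
interior S = interior-left {W} (interior-left {N} interior-N)
interior E = interior-left {S} (interior-left {W} (interior-left {N} interior-N))

-- After r + 5 levels the disk has shrunk into a translate of the attractor. Scaling the good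
-- position by the product of the first r + 5 factors 1 ± i makes it the translate of `Interior`,
-- which seven more levels merge.
big-disk′ : ∀ d c r → ∃[ n ] ∃[ τ ] (∀ e → norm (proj₁ e ⊕ ⊝ τ) ℕ.≤ r → ancestor c n e ≡ (O , d))
big-disk′ d c r = m ℕ.+ 7 , τ₀ , f
  where
  m = r ℕ.+ 5
  int = interior d (prefix (from c m) 7)
  τ₀ = βV (prefix c m) (proj₁ int)
  f : ∀ e → norm (proj₁ e ⊕ ⊝ τ₀) ℕ.≤ r → ancestor c (m ℕ.+ 7) e ≡ (O , d)
  f e p = trans (ancestor-+ c m 7 e) (trans (cong (ancestor (from c m) 7) anc≡)
            (proj₂ int (ancestor c m (e ⊞ ⊝ τ₀)) (ancestor-Kind r c (e ⊞ ⊝ τ₀) (ℕP.m≤n⇒m≤n+o 6 p))))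
    where
    anc≡ : ancestor c m e ≡ ancestor c m (e ⊞ ⊝ τ₀) ⊞ proj₁ int
    anc≡ = trans (cong (λ w → ancestor c m (w , proj₂ e)) (sym (⊝-⊕ (proj₁ e) τ₀))) (ancestorV-⊞ (prefix c m) (e ⊞ ⊝ τ₀) (proj₁ int))

abstract
  big-disk : ∀ d c r → ∃[ n ] ∃[ τ ] (∀ e → norm (proj₁ e ⊕ ⊝ τ) ℕ.≤ r → ancestor c n e ≡ (O , d))
  big-disk = big-disk′

-- Segments of the plane and the states that represent them.

reverseS : Segment → Segment
reverseS (p , d) = (p ⊕ dirVec d , opp d)

support-reverseS : ∀ a → support (reverseS a) ≡ support a
support-reverseS (p , E) = cong (_, horiz) (⊕-⊝ p (dirVec E))
support-reverseS (p , N) = cong (_, vert) (⊕-⊝ p (dirVec N))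
support-reverseS (p , W) = refl
support-reverseS (p , S) = refl

axis-support : ∀ a → proj₂ (support a) ≡ axis (proj₂ a)
axis-support (p , E) = refl
axis-support (p , N) = refl
axis-support (p , W) = refl
axis-support (p , S) = refl

support-ends : ∀ p h q d → support (p , h) ≡ support (q , d) → q ≡ p ⊎ q ≡ p ⊕ dirVec h
support-ends p E q E r = inj₁ (sym (cong proj₁ r))
support-ends p W q W r = inj₁ (sym (⊕-cancelʳ (dirVec W) (cong proj₁ r)))
support-ends p N q N r = inj₁ (sym (cong proj₁ r))
support-ends p S q S r = inj₁ (sym (⊕-cancelʳ (dirVec S) (cong proj₁ r)))
support-ends p E q W r = inj₂ (trans (sym (⊝-⊕ q (dirVec E))) (cong (_⊕ dirVec E) (sym (cong proj₁ r))))
support-ends p W q E r = inj₂ (sym (cong proj₁ r))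
support-ends p N q S r = inj₂ (trans (sym (⊝-⊕ q (dirVec N))) (cong (_⊕ dirVec N) (sym (cong proj₁ r))))
support-ends p S q N r = inj₂ (sym (cong proj₁ r))
support-ends p E q N r with cong proj₂ r
... | ()
support-ends p E q S r with cong proj₂ r
... | ()
support-ends p W q N r with cong proj₂ r
... | ()
support-ends p W q S r with cong proj₂ r
... | ()
support-ends p N q E r with cong proj₂ r
... | ()
support-ends p N q W r with cong proj₂ r
... | ()
support-ends p S q E r with cong proj₂ r
... | ()
support-ends p S q W r with cong proj₂ r
... | ()

turn-turnBy : ∀ s d → turn d (turnBy s d) ≡ s
turn-turnBy plus E = refl
turn-turnBy plus N = refl
turn-turnBy plus W = refl
turn-turnBy plus S = refl
turn-turnBy minus E = refl
turn-turnBy minus N = refl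
turn-turnBy minus W = refl
turn-turnBy minus S = refl

perp-turn : ∀ d d' → ¬ axis d ≡ axis d' → d' ≡ turnBy (turn d d') d
perp-turn E E p = ⊥-elim (p refl)
perp-turn E W p = ⊥-elim (p refl)
perp-turn W E p = ⊥-elim (p refl)
perp-turn W W p = ⊥-elim (p refl)
perp-turn N N p = ⊥-elim (p refl)
perp-turn N S p = ⊥-elim (p refl)
perp-turn S N p = ⊥-elim (p refl)
perp-turn S S p = ⊥-elim (p refl)
perp-turn E N p = refl
perp-turn E S p = refl
perp-turn W N p = refl
perp-turn W S p = refl
perp-turn N E p = refl
perp-turn N W p = refl
perp-turn S E p = refl
perp-turn S W p = refl

extend : Sign → Segment → Segment
extend s (p , d) = (p ⊕ dirVec d , turnBy s d)

turnBy-neg-turnBy : ∀ s d → turnBy s (turnBy (neg s) d) ≡ d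
turnBy-neg-turnBy s d = trans (cong (turnBy s) (turnBy-neg s d)) (turnBy-opp-turnBy s d)

extend-inj : ∀ s a b → extend s a ≡ extend s b → a ≡ b
extend-inj s (p , d) (q , h) r = cong₂ _,_ (⊕-cancelʳ (dirVec h) (trans (cong (λ x → p ⊕ dirVec x) (sym d≡h)) (cong proj₁ r))) d≡h
  where
  inv : ∀ x → turnBy (neg s) (turnBy s x) ≡ x
  inv x = trans (cong (λ u → turnBy (neg s) (turnBy u x)) (sym (neg-neg s))) (turnBy-neg-turnBy (neg s) x)
  d≡h : d ≡ h
  d≡h = trans (sym (inv d)) (trans (cong (turnBy (neg s)) (cong proj₂ r)) (inv h))

translateS : Point → Segment → Segment
translateS v (p , d) = (v ⊕ p , d)

translateS-inj : ∀ v a b → translateS v a ≡ translateS v b → a ≡ b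
translateS-inj v a b q = cong₂ _,_ (⊕-cancelˡ v (cong proj₁ q)) (cong proj₂ q)

support-translateS : ∀ v a → support (translateS v a) ≡ translateE v (support a)
support-translateS v (p , E) = refl
support-translateS v (p , N) = refl
support-translateS v (p , W) = cong (_, horiz) (⊕-assoc v p (dirVec W))
support-translateS v (p , S) = cong (_, vert) (⊕-assoc v p (dirVec S))

translateE-inj : ∀ v a b → translateE v a ≡ translateE v b → a ≡ b
translateE-inj v a b q = cong₂ _,_ (⊕-cancelˡ v (cong proj₁ q)) (cong proj₂ q)

curve-step : ∀ {C} → IsCompleteCurve C → ∀ i → C (ℤ.suc i) ≡ extend (assoc C i) (C i)
curve-step {C} (ends , perp , _) i = cong₂ _,_ (sym (ends i))
  (perp-turn (proj₂ (C i)) (proj₂ (C (ℤ.suc i))) (λ q → perp i (trans (axis-support (C i)) (trans q (sym (axis-support (C (ℤ.suc i))))))))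

β-rotate : ∀ s v → β s v ⊕ ⊝ rotate s v ≡ v
β-rotate plus (x , y) = p≡ (l1 x y) (l2 x y)
  where
  l1 : ∀ x y → x - y + - - y ≡ x
  l1 = solve-∀
  l2 : ∀ x y → x + y + - x ≡ y
  l2 = solve-∀
β-rotate minus (x , y) = p≡ (l1 x y) (l2 x y)
  where
  l1 : ∀ x y → x + y + - y ≡ x
  l1 = solve-∀
  l2 : ∀ x y → y - x + - - x ≡ y
  l2 = solve-∀

module Frame (a : Axis) (ε : Sign) (P : Point) where

  open Oriented a ε

  segmentBy : Bool → State → Segment
  segmentBy true  (w , d) = (P ⊕ pt w , d)
  segmentBy false (w , d) = ((P ⊕ pt w) ⊕ dirVec d , opp d)

  segment : State → Segment
  segment e = segmentBy (isOut e) e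

  edge : State → Edge
  edge (w , d) = support (P ⊕ pt w , d)

  support-segment : ∀ e → support (segment e) ≡ edge e
  support-segment e@(w , d) with isOut e
  ... | true  = refl
  ... | false = support-reverseS (P ⊕ pt w , d)

  -- The sign is the parity of the left or lower endpoint; if that one is odd, the base is the other
  -- endpoint and the direction points back.
  stateOfH stateOfV : Sign → Point → State
  stateOfH plus  z = (quo plus z , E)
  stateOfH minus z = (quo plus (z ⊕ dirVec E) , W)
  stateOfV plus  z = (quo plus z , N)
  stateOfV minus z = (quo plus (z ⊕ dirVec N) , S)

  stateOf : Edge → State
  stateOf (p , horiz) = stateOfH (parityP (p ⊕ ⊝ P)) (p ⊕ ⊝ P)
  stateOf (p , vert)  = stateOfV (parityP (p ⊕ ⊝ P)) (p ⊕ ⊝ P)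

  P⊕-⊝P : ∀ p → P ⊕ (p ⊕ ⊝ P) ≡ p
  P⊕-⊝P p = trans (⊕-comm P (p ⊕ ⊝ P)) (⊝-⊕ p P)

  ⊕P-⊝P : ∀ z → (P ⊕ z) ⊕ ⊝ P ≡ z
  ⊕P-⊝P z = trans (cong (_⊕ ⊝ P) (⊕-comm P z)) (⊕-⊝ z P)

  odd-next : ∀ z d → parityP z ≡ minus → parityP (z ⊕ dirVec d) ≡ plus
  odd-next z d p = trans (parityP-⊕ z (dirVec d)) (cong₂ _·_ p (parityP-dirVec d))

  odd-back : ∀ p d → parityP (p ⊕ ⊝ P) ≡ minus → (P ⊕ pt (quo plus ((p ⊕ ⊝ P) ⊕ dirVec d))) ⊕ dirVec (opp d) ≡ p
  odd-back p d q =
    trans (cong₂ (λ u v → (P ⊕ u) ⊕ v) (β-quo plus (z ⊕ dirVec d) (odd-next z d q)) (dirVec-opp d))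
      (trans (cong (_⊕ ⊝ dirVec d) (sym (⊕-assoc P z (dirVec d)))) (trans (⊕-⊝ (P ⊕ z) (dirVec d)) (P⊕-⊝P p)))
    where z = p ⊕ ⊝ P

  edge-stateOf : ∀ ed → edge (stateOf ed) ≡ ed
  edge-stateOf (p , horiz) with parityP (p ⊕ ⊝ P) in eq
  ... | plus  = cong (_, horiz) (trans (cong (P ⊕_) (β-quo plus (p ⊕ ⊝ P) eq)) (P⊕-⊝P p))
  ... | minus = cong (_, horiz) (odd-back p E eq)
  edge-stateOf (p , vert) with parityP (p ⊕ ⊝ P) in eq
  ... | plus  = cong (_, vert) (trans (cong (P ⊕_) (β-quo plus (p ⊕ ⊝ P) eq)) (P⊕-⊝P p))
  ... | minus = cong (_, vert) (odd-back p N eq)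

  back-z : ∀ w d → ((P ⊕ pt w) ⊕ dirVec d) ⊕ ⊝ P ≡ pt w ⊕ dirVec d
  back-z w d = trans (cong (_⊕ ⊝ P) (⊕-assoc P (pt w) (dirVec d))) (⊕P-⊝P (pt w ⊕ dirVec d))

  parityP-back : ∀ w d → parityP (pt w ⊕ dirVec d) ≡ minus
  parityP-back w d = trans (parityP-⊕ (pt w) (dirVec d)) (cong₂ _·_ (parityP-β plus w) (parityP-dirVec d))

  stateOf-edge : ∀ e → stateOf (edge e) ≡ e
  stateOf-edge (w , E) = trans (cong (λ z → stateOfH (parityP z) z) (⊕P-⊝P (pt w)))
    (trans (cong (λ s → stateOfH s (pt w)) (parityP-β plus w)) (cong (_, E) (quo-β plus w)))
  stateOf-edge (w , N) = trans (cong (λ z → stateOfV (parityP z) z) (⊕P-⊝P (pt w)))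
    (trans (cong (λ s → stateOfV s (pt w)) (parityP-β plus w)) (cong (_, N) (quo-β plus w)))
  stateOf-edge (w , W) = trans (cong (λ z → stateOfH (parityP z) z) (back-z w W))
    (trans (cong (λ s → stateOfH s (pt w ⊕ dirVec W)) (parityP-back w W))
      (cong (_, W) (trans (cong (quo plus) (⊝-⊕ (pt w) (dirVec E))) (quo-β plus w))))
  stateOf-edge (w , S) = trans (cong (λ z → stateOfV (parityP z) z) (back-z w S))
    (trans (cong (λ s → stateOfV s (pt w ⊕ dirVec S)) (parityP-back w S))
      (cong (_, S) (trans (cong (quo plus) (⊝-⊕ (pt w) (dirVec N))) (quo-β plus w))))

  edge-inj : ∀ e f → edge e ≡ edge f → e ≡ f
  edge-inj e f q = trans (sym (stateOf-edge e)) (trans (cong stateOf q) (stateOf-edge f))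

  stateOf-segment : ∀ e → stateOf (support (segment e)) ≡ e
  stateOf-segment e = trans (cong stateOf (support-segment e)) (stateOf-edge e)

  segment-nx : ∀ s e → segment (nx s e) ≡ extend s (segment e)
  segment-nx s (w , d) with out d in eq
  ... | true rewrite out-opp-turnBy s d | eq = cong₂ _,_ l (opp-opp (turnBy s d))
    where
    l : (P ⊕ pt (w ⊕ δ s (dirVec d))) ⊕ dirVec (opp (turnBy s d)) ≡ (P ⊕ pt w) ⊕ dirVec d
    l = trans (cong₂ (λ u v → (P ⊕ u) ⊕ v) (trans (β-⊕ plus w (δ s (dirVec d))) (cong (pt w ⊕_) (β-δ s (dirVec d))))
                (trans (dirVec-opp (turnBy s d)) (cong ⊝_ (dirVec-turnBy s d))))
          (trans (cong (_⊕ ⊝ rotate s (dirVec d)) (sym (⊕-assoc P (pt w) (β s (dirVec d)))))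
            (trans (⊕-assoc (P ⊕ pt w) (β s (dirVec d)) (⊝ rotate s (dirVec d))) (cong ((P ⊕ pt w) ⊕_) (β-rotate s (dirVec d)))))
  ... | false rewrite out-turnBy-opp s d | eq =
    cong (_, turnBy s (opp d)) (sym (trans (cong (((P ⊕ pt w) ⊕ dirVec d) ⊕_) (dirVec-opp d)) (⊕-⊝ (P ⊕ pt w) (dirVec d))))

  previousBy : Bool → Sign → State → State
  previousBy true  s (w , d) = (w , opp (turnBy (neg s) d))
  previousBy false s (w , d) = (w ⊕ ⊝ δ s (dirVec (turnBy (neg s) (opp d))) , turnBy (neg s) (opp d))

  previous : Sign → State → State
  previous s f = previousBy (isOut f) s f

  nx-previous : ∀ s f → nx s (previous s f) ≡ f
  nx-previous s (w , d) with out d in eq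
  ... | true rewrite out-opp-turnBy (neg s) d | eq =
    cong (w ,_) (trans (cong (turnBy s) (opp-opp (turnBy (neg s) d))) (turnBy-neg-turnBy s d))
  ... | false rewrite out-turnBy-opp (neg s) d | eq =
    cong₂ _,_ (⊝-⊕ w _) (trans (cong opp (turnBy-neg-turnBy s (opp d))) (opp-opp d))

  ⊕-swap : ∀ v p q → v ⊕ (p ⊕ q) ≡ p ⊕ (q ⊕ v)
  ⊕-swap v p q = trans (⊕-comm v (p ⊕ q)) (⊕-assoc p q v)

  segment-⊞ : ∀ e τ → segment (e ⊞ τ) ≡ translateS (pt τ) (segment e)
  segment-⊞ (w , d) τ with out d
  ... | true  = cong (_, d) l
    where
    l : P ⊕ pt (w ⊕ τ) ≡ pt τ ⊕ (P ⊕ pt w)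
    l = trans (cong (P ⊕_) (β-⊕ plus w τ)) (sym (⊕-swap (pt τ) P (pt w)))
  ... | false = cong (_, opp d) (trans (cong (_⊕ dirVec d) l) (⊕-assoc (pt τ) (P ⊕ pt w) (dirVec d)))
    where
    l : P ⊕ pt (w ⊕ τ) ≡ pt τ ⊕ (P ⊕ pt w)
    l = trans (cong (P ⊕_) (β-⊕ plus w τ)) (sym (⊕-swap (pt τ) P (pt w)))

  edge-⊞ : ∀ e τ → edge (e ⊞ τ) ≡ translateE (pt τ) (edge e)
  edge-⊞ e τ = trans (sym (support-segment (e ⊞ τ))) (trans (cong support (segment-⊞ e τ))
    (trans (support-translateS (pt τ) (segment e)) (cong (translateE (pt τ)) (support-segment e))))

  nx-⊞ : ∀ s e τ → nx s (e ⊞ τ) ≡ nx s e ⊞ τ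
  nx-⊞ s (w , d) τ with out d
  ... | true  = cong (_, opp (turnBy s d)) (trans (⊕-assoc w τ v) (trans (cong (w ⊕_) (⊕-comm τ v)) (sym (⊕-assoc w v τ))))
    where v = δ s (dirVec d)
  ... | false = refl

  endpoint-⊞ : ∀ e τ → endpoint (e ⊞ τ) ≡ endpoint e ⊕ pt τ
  endpoint-⊞ (w , d) τ with out d
  ... | true  = trans (cong (_⊕ dirVec d) (β-⊕ plus w τ)) (trans (⊕-assoc (pt w) (pt τ) (dirVec d))
                  (trans (cong (pt w ⊕_) (⊕-comm (pt τ) (dirVec d))) (sym (⊕-assoc (pt w) (dirVec d) (pt τ)))))
  ... | false = β-⊕ plus w τ

  end-segment : ∀ e → end (segment e) ≡ P ⊕ endpoint e
  end-segment (w , d) with out d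
  ... | true  = ⊕-assoc P (pt w) (dirVec d)
  ... | false = trans (cong (((P ⊕ pt w) ⊕ dirVec d) ⊕_) (dirVec-opp d)) (⊕-⊝ (P ⊕ pt w) (dirVec d))

  endpoint-in : ∀ e → isOut e ≡ false → endpoint e ≡ pt (proj₁ e)
  endpoint-in (w , d) p rewrite p = refl

-- Local isomorphism forces the predicted turns.

module Disk (a : Axis) (ε : Sign) where
  open Oriented a ε
  open Paths a ε
  open Central

  -- By descent: if the parent has index j in the derived path, its incoming half has index 2j and
  -- its outgoing half 2j - 1.
  on-Central : ∀ {d₁} n {c s X} → Central d₁ c s X → ∀ e → ancestor c n e ≡ (O , d₁) → ∃[ m ] e ≡ X m
  on-Central zero    Z e q = 1ℤ , trans q (sym (begin Z))
  on-Central (suc n) {c} {s} {X} Z e q with on-Central n (Central-derive Z) (parent (c 0) e) q | isOut e in eq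
  ... | j , r | false = j + j , parent-inj (c 0) e (X (j + j)) (trans eq (sym (in-even Z j))) r
  ... | j , r | true  = ℤ.suc (h + h) , parent-inj (c 0) e (X (ℤ.suc (h + h))) (trans eq (sym (out-odd Z h)))
                          (trans r (trans (cong (derive c X) (sym (suc-pred j))) (derive-suc Z h)))
    where h = j - + 1

module Cover (ε : Sign) (c : ℕ → Sign) (s : ℤ → Sign) (H : Hierarchy.Hier ε c s)
             (C : ℤ → Segment) (cc : IsCompleteCurve C) (as : ∀ i → assoc C i ≡ s i)
             (I : Set) (ι : I → ℤ → Segment)
             (cov : IsCovering I ι) (con : ContainsCurve I ι C) where

  open Hierarchy ε

  P : Point
  P = proj₁ (C 1ℤ)

  d₁ : Dir
  d₁ = proj₂ (C 1ℤ)

  a : Axis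
  a = axis d₁

  open Oriented a ε public
  open Paths a ε public
  open Frame a ε P public
  open Disk a ε public
  open Central

  look : Edge → I × ℤ
  look ed = proj₁ (proj₂ cov ed)

  support-look : ∀ ed → support (ι (proj₁ (look ed)) (proj₂ (look ed))) ≡ ed
  support-look ed = proj₁ (proj₂ (proj₂ cov ed))

  look-unique : ∀ ed i k → support (ι i k) ≡ ed → look ed ≡ (i , k)
  look-unique ed i k q = proj₂ (proj₂ (proj₂ cov ed)) q

  ι-inj : ∀ i k j l → support (ι i k) ≡ support (ι j l) → (i , k) ≡ (j , l)
  ι-inj i k j l q = trans (sym (look-unique _ i k q)) (look-unique _ j l refl)

  out-d₁ : out d₁ ≡ true
  out-d₁ with axis d₁
  ... | horiz = refl
  ... | vert  = refl

  C1 : C 1ℤ ≡ segment (O , d₁)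
  C1 = sym (trans (cong (λ b → segmentBy b (O , d₁)) out-d₁) (cong (_, d₁) (⊕-idʳ P)))

  C-step : ∀ k → C (ℤ.suc k) ≡ extend (s k) (C k)
  C-step k = trans (curve-step cc k) (cong (λ t → extend t (C k)) (as k))

  -- Segment 1 obeys the convention that even vertices are left along `a`, and each turn preserves
  -- it, forwards and backwards.
  C-segment : ∀ k → ∃[ e ] C k ≡ segment e
  C-segment = ℤ-ind _ (down 0ℤ ((O , d₁) , C1)) up down
    where
    up : ∀ k → ∃[ e ] C k ≡ segment e → ∃[ e ] C (ℤ.suc k) ≡ segment e
    up k (e , q) = nx (s k) e , trans (C-step k) (trans (cong (extend (s k)) q) (sym (segment-nx (s k) e)))
    down : ∀ k → ∃[ e ] C (ℤ.suc k) ≡ segment e → ∃[ e ] C k ≡ segment e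
    down k (f , q) = previous (s k) f , extend-inj (s k) (C k) (segment (previous (s k) f))
      (trans (sym (C-step k)) (trans q (trans (cong segment (sym (nx-previous (s k) f))) (segment-nx (s k) (previous (s k) f)))))

  X : ℤ → State
  X k = stateOf (support (C k))

  CX : ∀ k → C k ≡ segment (X k)
  CX k = let (e , q) = C-segment k in trans q (cong segment (sym (trans (cong (stateOf ∘ support) q) (stateOf-segment e))))

  X-of : ∀ k e → C k ≡ segment e → X k ≡ e
  X-of k e q = trans (cong (stateOf ∘ support) q) (stateOf-segment e)

  central : Central d₁ c s X
  central = record
    { hier = H
    ; steps = λ k → X-of (ℤ.suc k) (nx (s k) (X k))
        (trans (C-step k) (trans (cong (extend (s k)) (CX k)) (sym (segment-nx (s k) (X k)))))
    ; begin = X-of 1ℤ (O , d₁) C1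
    ; begin-out = out-d₁ }

  i₀ : I
  i₀ = proj₁ con

  κ : ℤ
  κ = proj₁ (proj₂ con)

  ιC : ∀ k → ι i₀ (k + κ) ≡ C k
  ιC = proj₂ (proj₂ con)

  +-swap : ∀ x y z → x + y + z ≡ x + z + y
  +-swap = solve-∀

  decorated-C : ∀ k → decorated (ι i₀) (k + κ) ≡ decorated C k
  decorated-C k = cong₂ _,_ (cong support (trans (cong (ι i₀) (+-swap k κ (- + 1))) (ιC (k - + 1))))
    (cong₂ _,_ (ιC k) (cong support (trans (cong (ι i₀) (+-swap k κ (+ 1))) (ιC (k + + 1)))))

  OnC : DecSeg → Set
  OnC D = ∃[ m ] decorated C m ≡ D

  even-end : ∀ b → ∃[ e ] (edge e ≡ support b × (P ⊕ pt (proj₁ e) ≡ start b ⊎ P ⊕ pt (proj₁ e) ≡ end b))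
  even-end b@(p , h) = e , edge-stateOf (support b) ,
      support-ends p h (P ⊕ pt (proj₁ e)) (proj₂ e) (sym (edge-stateOf (support b)))
    where e = stateOf (support b)

  -- Bases are measured in units of 1 + i, so the squared distance is twice the norm; the factor 2
  -- is given away.
  InDisk⇒nn : ∀ w τ r → InDisk (P ⊕ pt τ) r (P ⊕ pt w) → norm (w ⊕ ⊝ τ) ℕ.≤ r ℕ.* r
  InDisk⇒nn w τ r p = ℕP.≤-trans (ℕP.m≤m+n (norm (w ⊕ ⊝ τ)) (norm (w ⊕ ⊝ τ)))
    (ℕP.≤-trans (ℕP.≤-reflexive (sym (norm-β plus (w ⊕ ⊝ τ)))) (ℤP.drop‿+≤+ (subst (ℤ._≤ + (r ℕ.* r)) q p)))
    where
    z = P ⊕ pt w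
    t = P ⊕ pt τ
    l : z ⊕ ⊝ t ≡ pt (w ⊕ ⊝ τ)
    l = trans (p≡ (l1 (proj₁ P) (proj₁ (pt w)) (proj₁ (pt τ))) (l1 (proj₂ P) (proj₂ (pt w)) (proj₂ (pt τ))))
          (trans (cong (pt w ⊕_) (sym (β-⊝ plus τ))) (sym (β-⊕ plus w (⊝ τ))))
      where
      l1 : ∀ p x y → (p + x) - (p + y) ≡ x - y
      l1 = solve-∀
    q : (proj₁ z - proj₁ t) * (proj₁ z - proj₁ t) + (proj₂ z - proj₂ t) * (proj₂ z - proj₂ t) ≡ + norm (pt (w ⊕ ⊝ τ))
    q = trans (cong (λ u → proj₁ u * proj₁ u + proj₂ u * proj₂ u) l) (sym (+nn (pt (w ⊕ ⊝ τ))))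

  -- All edges of the disk descend from (`O`, `d₁`) and so lie on C. An edge has only one place in
  -- the covering, hence the decorations are those of C as well.
  disk-in-C : ∀ r → ∃[ z ] (∀ D → SegInDisk z r D → IsDecSegOf I ι D → OnC D)
  disk-in-C r with big-disk d₁ c (r ℕ.* r)
  ... | n , τ , f = P ⊕ pt τ , g
    where
    g : ∀ D → SegInDisk (P ⊕ pt τ) r D → IsDecSegOf I ι D → OnC D
    g D (sd , ed) (i , k , refl) with even-end (ι i k)
    ... | e , q , ends = m , sym (trans (cong₂ (λ i k → decorated (ι i) k) (cong proj₁ ik) (cong proj₂ ik)) (decorated-C m))
      where
      near : norm (proj₁ e ⊕ ⊝ τ) ℕ.≤ r ℕ.* r
      near = InDisk⇒nn (proj₁ e) τ r
        ([ (λ h → subst (InDisk (P ⊕ pt τ) r) (sym h) sd) , (λ h → subst (InDisk (P ⊕ pt τ) r) (sym h) ed) ]′ ends)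
      on = on-Central n central e (f e near)
      m = proj₁ on
      ik : (i , k) ≡ (i₀ , m + κ)
      ik = ι-inj i k i₀ (m + κ) (trans (sym q) (trans (cong edge (proj₂ on))
             (trans (sym (support-segment (X m))) (cong support (trans (sym (CX m)) (sym (ιC m)))))))

  module _ (loc : LocalIso I ι) where

    -- Joining `D` and the segments 0 to `L` of `C` in one pattern gives both the same vector `v`;
    -- the target disk, where only `C` is seen, puts both copies on `C`.
    copy′ : ∀ D → IsDecSegOf I ι D → ∀ L → ∃[ v ] ∃[ m ] ∃[ m₀ ] (decorated C m ≡ translateD v D
              × (∀ j → j ℕ.≤ L → decorated C (+ j + m₀) ≡ translateD v (decorated C (+ j))))
    copy′ D D-of L = v , m , m₀ , m-copy , C-tr
      where
      F : List DecSeg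
      F = D ∷ applyUpTo (λ j → decorated C (+ j)) (suc L)
      F-of : All (IsDecSegOf I ι) F
      F-of = D-of ∷ AllP.applyUpTo⁺₂ (λ j → decorated C (+ j)) (suc L) (λ j → i₀ , + j + κ , decorated-C (+ j))
      iso = loc F F-of
      dsk = disk-in-C (proj₁ iso)
      cpy = proj₂ iso (proj₁ dsk)
      v = proj₁ cpy
      F-on : All (OnC ∘ translateD v) F
      F-on = All.zipWith (λ {D} (p , q) → proj₂ dsk (translateD v D) p q)
               (AllP.map⁻ (proj₁ (proj₂ cpy)) , AllP.map⁻ (proj₂ (proj₂ cpy)))
      m = proj₁ (All.head F-on)
      m-copy : decorated C m ≡ translateD v D
      m-copy = proj₂ (All.head F-on)
      C-on : ∀ j → j ℕ.≤ L → OnC (translateD v (decorated C (+ j)))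
      C-on j p = AllP.applyUpTo⁻ (λ j → decorated C (+ j)) (suc L) (All.tail F-on) (ℕ.s≤s p)
      m₀ = proj₁ (C-on 0 ℕ.z≤n)
      C-tr : ∀ j → j ℕ.≤ L → decorated C (+ j + m₀) ≡ translateD v (decorated C (+ j))
      C-tr zero    p = trans (cong (decorated C) (ℤP.+-identityˡ m₀)) (proj₂ (C-on 0 ℕ.z≤n))
      C-tr (suc j) p = trans (cong (decorated C) eq) (proj₂ (C-on (suc j) p))
        where
        mj = proj₁ (C-on (suc j) p)
        l1 : ∀ j m → j + m + + 1 ≡ + 1 + j + m
        l1 = solve-∀
        -- The decoration records the following support, so copies of successive segments are
        -- successive on C.
        eq : + suc j + m₀ ≡ mj
        eq = trans (sym (l1 (+ j) m₀)) (proj₂ (proj₂ cc)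
          (trans (cong (proj₂ ∘ proj₂) (C-tr j (ℕP.≤-trans (ℕP.n≤1+n j) p)))
            (trans (cong (λ x → translateE v (support (C x))) (ℤP.+-comm (+ j) (+ 1)))
              (trans (sym (support-translateS v (C (+ suc j))))
                (cong support (sym (cong (proj₁ ∘ proj₂) (proj₂ (C-on (suc j) p)))))))))

    abstract
      copy : ∀ D → IsDecSegOf I ι D → ∀ L → ∃[ v ] ∃[ m ] ∃[ m₀ ] (decorated C m ≡ translateD v D
               × (∀ j → j ℕ.≤ L → decorated C (+ j + m₀) ≡ translateD v (decorated C (+ j))))
      copy = copy′

    -- `next` concerns a support because a decoration records no more; the orientation of the next
    -- segment is `at` for the next edge.
    record Follow (e : State) : Set where
      field
        idx     : I
        pos     : ℤ
        at      : ι idx pos ≡ segment e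
        sgn     : Sign
        sgnTurn : Turn c (endpoint e) sgn
        next    : support (ι idx (pos + + 1)) ≡ edge (nx sgn e)

    -- Translating a long piece of C together with an edge into a disk covered by C
    -- moves it by an element of a deep level, which does not change the predicted turn.
    follow : ∀ e → Follow e
    follow e = record { idx = i ; pos = k ; at = at-e ; sgn = t ; sgnTurn = T ; next = next-e }
      where
      i = proj₁ (look (edge e))
      k = proj₂ (look (edge e))
      total = Turn-total (norm (endpoint e)) c (endpoint e) ℕP.≤-refl
      t = proj₁ total
      T = proj₂ total
      n = 2 ℕ.+ depth T
      -- A turn is read from two segments, so one more segment than turns is needed.
      L = suc (window n)
      cpy = copy (decorated (ι i) k) (i , k , refl) L
      v = proj₁ cpy
      m = proj₁ (proj₂ cpy)
      m₀ = proj₁ (proj₂ (proj₂ cpy))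
      m-copy : decorated C m ≡ translateD v (decorated (ι i) k)
      m-copy = proj₁ (proj₂ (proj₂ (proj₂ cpy)))
      C-tr : ∀ j → j ℕ.≤ L → decorated C (+ j + m₀) ≡ translateD v (decorated C (+ j))
      C-tr = proj₂ (proj₂ (proj₂ (proj₂ cpy)))
      C-segment-tr : ∀ j → j ℕ.≤ L → C (+ j + m₀) ≡ translateS v (C (+ j))
      C-segment-tr j p = cong (proj₁ ∘ proj₂) (C-tr j p)
      s-per : ∀ j → j ℕ.≤ window n → s (+ j + m₀) ≡ s (+ j)
      s-per j p = trans (sym (as (+ j + m₀))) (trans
        (cong₂ turn (cong proj₂ (C-segment-tr j (ℕP.m≤n⇒m≤1+n p)))
          (trans (cong (proj₂ ∘ C) (sym (ℤP.+-assoc (+ 1) (+ j) m₀))) (cong proj₂ (C-segment-tr (suc j) (ℕ.s≤s p)))))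
        (as (+ j)))
      m₀-div : Div2 n m₀
      m₀-div = recognise n H m₀ s-per
      τ = proj₁ (X m₀)
      m₀-in : isOut (X m₀) ≡ false
      m₀-in = trans (cong (isOut ∘ X) (proj₁ (proj₂ m₀-div))) (in-even central (proj₁ m₀-div))
      end₀ : endpoint (X m₀) ≡ pt τ
      end₀ = endpoint-in (X m₀) m₀-in
      end-tr : ∀ b → end (translateS v b) ≡ v ⊕ end b
      end-tr (p , d) = ⊕-assoc v p (dirVec d)
      -- Segment 0 ends at P, so its copy, segment m₀, ends at P + v; as m₀ is even, this is an even
      -- vertex, with base τ.
      v≡ : v ≡ pt τ
      v≡ = sym (trans (sym end₀) (⊕-cancelˡ P (trans (sym (end-segment (X m₀))) (trans (cong end (sym (CX m₀)))
             (trans (cong end (trans (cong C (sym (ℤP.+-identityˡ m₀))) (C-segment-tr 0 ℕ.z≤n)))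
               (trans (end-tr (C 0ℤ)) (trans (cong (v ⊕_) (trans (cong end (CX 0ℤ)) (trans (end-segment (X 0ℤ))
                  (trans (cong (P ⊕_) (centre-O central)) (⊕-idʳ P))))) (⊕-comm v P))))))))
      Cm : C m ≡ translateS (pt τ) (ι i k)
      Cm = trans (cong (proj₁ ∘ proj₂) m-copy) (cong (λ v → translateS v (ι i k)) v≡)
      Xm : X m ≡ e ⊞ τ
      Xm = edge-inj (X m) (e ⊞ τ) (trans (sym (support-segment (X m))) (trans (cong support (trans (sym (CX m)) Cm))
             (trans (support-translateS (pt τ) (ι i k)) (trans (cong (translateE (pt τ)) (support-look (edge e))) (sym (edge-⊞ e τ))))))
      at-e : ι i k ≡ segment e
      at-e = translateS-inj (pt τ) (ι i k) (segment e) (trans (sym Cm) (trans (CX m) (trans (cong segment Xm) (segment-⊞ e τ))))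
      endm : endpoint (X m) ≡ endpoint e ⊕ endpoint (X m₀)
      endm = trans (cong endpoint Xm) (trans (endpoint-⊞ e τ) (cong (endpoint e ⊕_) (sym end₀)))
      turns = Central-turns central
      sm≡t : s m ≡ t
      sm≡t with endpoint e ≟P O
      ... | no  z≢O = Turn-unique (subst (λ z → Turn c z (s m)) endm (turns m)) (Turn-shift central T z≢O m₀ m₀-div)
      -- At the origin there is no level to compare: the translated vertex is the end of the copy of
      -- segment 0, whose turn is ε.
      ... | yes z≡O = trans (Turn-unique (subst (λ z → Turn c z (s m)) (trans endm (trans (cong (_⊕ endpoint (X m₀)) z≡O) (⊕-idˡ (endpoint (X m₀))))) (turns m)) (turns m₀))
            (trans (cong s (sym (ℤP.+-identityˡ m₀))) (trans (s-per 0 ℕ.z≤n) (trans (centre H) (sym (Turn-O z≡O T)))))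
      next-e : support (ι i (k + + 1)) ≡ edge (nx t e)
      next-e = translateE-inj (pt τ) _ _ (trans (cong (λ v → translateE v (support (ι i (k + + 1)))) (sym v≡))
        (trans (sym (cong (proj₂ ∘ proj₂) m-copy))
          (trans (cong (support ∘ C) (ℤP.+-comm m (+ 1)))
            (trans (cong support (CX (ℤ.suc m))) (trans (support-segment (X (ℤ.suc m)))
              (trans (cong edge (trans (steps central m) (trans (cong₂ nx sm≡t Xm) (nx-⊞ t e τ)))) (edge-⊞ (nx t e) τ)))))))

-- Finite comparisons of edges near the origin.

pattern f0 = fz
pattern f1 = fs fz
pattern f2 = fs f1
pattern f3 = fs f2
pattern f4 = fs f3
pattern f5 = fs f4

∀-dirs? : {P : Dir → Set} → (∀ d → Dec (P d)) → Dec (∀ d → P d)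
∀-dirs? P? = map′ (λ qs d → lookupAll qs (dir-any d)) (λ f → All.tabulate (λ {d} _ → f d)) (All.all? P? dirs)

∀-signs? : {P : Sign → Set} → (∀ s → Dec (P s)) → Dec (∀ s → P s)
∀-signs? P? with P? plus | P? minus
... | yes p | yes q = yes λ { plus → p ; minus → q }
... | no ¬p | _     = no (λ f → ¬p (f plus))
... | _     | no ¬q = no (λ f → ¬q (f minus))

stA stB : Dir → State
stA d = (⊝ dirVec d , d)
stB d = (⊝ dirVec d , left d)

parent-plus-A : ∀ d → parent plus (stA d) ≡ stB d
parent-plus-A E = refl
parent-plus-A N = refl
parent-plus-A W = refl
parent-plus-A S = refl

parent-minus-A : ∀ d → parent minus (stA d) ≡ (O , right d)
parent-minus-A E = refl
parent-minus-A N = refl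
parent-minus-A W = refl
parent-minus-A S = refl

parent-plus-B : ∀ d → parent plus (stB d) ≡ (O , opp d)
parent-plus-B E = refl
parent-plus-B N = refl
parent-plus-B W = refl
parent-plus-B S = refl

parent-minus-B : ∀ d → parent minus (stB d) ≡ stA d
parent-minus-B E = refl
parent-minus-B N = refl
parent-minus-B W = refl
parent-minus-B S = refl

sameAxis-cases : ∀ d d' → sameAxis (axis d) (axis d') ≡ true → d' ≡ d ⊎ d' ≡ opp d
sameAxis-cases E E _ = inj₁ refl
sameAxis-cases E W _ = inj₂ refl
sameAxis-cases W E _ = inj₂ refl
sameAxis-cases W W _ = inj₁ refl
sameAxis-cases N N _ = inj₁ refl
sameAxis-cases N S _ = inj₂ refl
sameAxis-cases S N _ = inj₂ refl
sameAxis-cases S S _ = inj₁ refl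

d≢opp : ∀ d → ¬ d ≡ opp d
d≢opp E ()
d≢opp N ()
d≢opp W ()
d≢opp S ()

O≢A : ∀ d d' → ¬ (O , d) ≡ stA d'
O≢A = toWitness {a? = ∀-dirs? λ d → ∀-dirs? λ d' → ¬? ((O , d) ≟St stA d')} tt

-- The left side is the successor of an edge leaving the origin after a left turn, the turn
-- predicted when the current sign is plus. The statements below treat `stA` in the same way:
-- outgoing it turns right, incoming it may turn either way.
next-O≢O : ∀ d d' → ¬ (O ⊕ dirVec d , opp (left d)) ≡ (O , d')
next-O≢O = toWitness {a? = ∀-dirs? λ d → ∀-dirs? λ d' → ¬? ((O ⊕ dirVec d , opp (left d)) ≟St (O , d'))} tt

next-O≢A : ∀ d d' → ¬ (O ⊕ dirVec d , opp (left d)) ≡ stA d'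
next-O≢A = toWitness {a? = ∀-dirs? λ d → ∀-dirs? λ d' → ¬? ((O ⊕ dirVec d , opp (left d)) ≟St stA d')} tt

next-outA≢O : ∀ d d' → ¬ (⊝ dirVec d ⊕ δ minus (dirVec d) , opp (right d)) ≡ (O , d')
next-outA≢O = toWitness {a? = ∀-dirs? λ d → ∀-dirs? λ d' → ¬? ((⊝ dirVec d ⊕ δ minus (dirVec d) , opp (right d)) ≟St (O , d'))} tt

next-outA≢A : ∀ d d' → ¬ (⊝ dirVec d ⊕ δ minus (dirVec d) , opp (right d)) ≡ stA d'
next-outA≢A = toWitness {a? = ∀-dirs? λ d → ∀-dirs? λ d' → ¬? ((⊝ dirVec d ⊕ δ minus (dirVec d) , opp (right d)) ≟St stA d')} tt

next-inA≢O : ∀ t d d' → ¬ (⊝ dirVec d , turnBy t (opp d)) ≡ (O , d')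
next-inA≢O = toWitness {a? = ∀-signs? λ t → ∀-dirs? λ d → ∀-dirs? λ d' → ¬? ((⊝ dirVec d , turnBy t (opp d)) ≟St (O , d'))} tt

next-inA≢A : ∀ t d d' → ¬ (⊝ dirVec d , turnBy t (opp d)) ≡ stA d'
next-inA≢A = toWitness {a? = ∀-signs? λ t → ∀-dirs? λ d → ∀-dirs? λ d' → ¬? ((⊝ dirVec d , turnBy t (opp d)) ≟St stA d')} tt

ancestor-suc : ∀ c n e → ancestor c (suc n) e ≡ parent (c n) (ancestor c n e)
ancestor-suc c zero    e = refl
ancestor-suc c (suc n) e = ancestor-suc (tail c) n (parent (c 0) e)

ancestor-O : ∀ c n d → ancestor c n (O , d) ≡ (O , d)
ancestor-O c zero    d = refl
ancestor-O c (suc n) d = trans (cong (ancestor (tail c) n) (Paths.parent-O vert plus (c 0) d)) (ancestor-O (tail c) n d)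

abstract
  ancestor-Kind-from : ∀ c e n → norm (proj₁ e) ℕ.+ 5 ℕ.≤ n → Kind (ancestor c n e)
  ancestor-Kind-from c e n p = subst (λ k → Kind (ancestor c k e)) (ℕP.m∸n+n≡m (ℕP.≤-trans (ℕP.m≤n+m 5 (norm (proj₁ e))) p))
    (ancestor-Kind (n ℕ.∸ 5) c e (ℕP.≤-trans (subst (ℕ._≤ n ℕ.∸ 5) (ℕP.m+n∸n≡m (norm (proj₁ e)) 5) (ℕP.∸-monoˡ-≤ 5 p)) (ℕP.m≤m+n _ 6)))

-- Eventually alternating signs.

twice : ℕ → ℕ
twice zero    = 0
twice (suc k) = suc (suc (twice k))

n≤twice : ∀ n → n ℕ.≤ twice n
n≤twice zero    = ℕ.z≤n
n≤twice (suc n) = ℕ.s≤s (ℕP.m≤n⇒m≤1+n (n≤twice n))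

altSign-twice : ∀ n → altSign (twice n) ≡ plus
altSign-twice zero    = refl
altSign-twice (suc n) = trans (neg-neg _) (altSign-twice n)

ancestor-A : ∀ k c d → (∀ j → c j ≡ altSign j) → ancestor c (twice k) (stA d) ≡ stA d
ancestor-A zero    c d alt = refl
ancestor-A (suc k) c d alt = trans (cong (λ e → ancestor (tail (tail c)) (twice k) e)
    (trans (cong₂ (λ x y → parent y (parent x (stA d))) (alt 0) (alt 1)) (trans (cong (parent minus) (parent-plus-A d)) (parent-minus-B d))))
  (ancestor-A k (tail (tail c)) d (λ j → trans (alt (suc (suc j))) (neg-neg _)))

-- This unfolds to `FiniteOrCofinite R` when c n is a_{2^n}. There are only two signs, so the finite
-- case is alternation in the opposite phase.
EventuallyAlternating : (ℕ → Sign) → Set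
EventuallyAlternating c = (∃[ m ] ∀ n → m ℕ.≤ n → ¬ c n ≡ altSign n) ⊎ (∃[ m ] ∀ n → m ℕ.≤ n → c n ≡ altSign n)

≢⇒neg : ∀ {s t} → ¬ s ≡ t → s ≡ neg t
≢⇒neg {plus}  {plus}  p = ⊥-elim (p refl)
≢⇒neg {minus} {minus} p = ⊥-elim (p refl)
≢⇒neg {plus}  {minus} p = refl
≢⇒neg {minus} {plus}  p = refl

alternating⇒EventuallyAlternating : ∀ c m → (∀ n → m ℕ.≤ n → c (suc n) ≡ neg (c n)) → EventuallyAlternating c
alternating⇒EventuallyAlternating c m alt = go (c m) (altSign m) refl refl
  where
  ratio : ∀ t → c m ≡ t · altSign m → ∀ k → c (k ℕ.+ m) ≡ t · altSign (k ℕ.+ m)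
  ratio t q zero    = q
  ratio t q (suc k) = trans (alt (k ℕ.+ m) (ℕP.m≤n+m m k)) (trans (cong neg (ratio t q k)) (sym (·-neg t _)))
  ratio' : ∀ t → c m ≡ t · altSign m → ∀ n → m ℕ.≤ n → c n ≡ t · altSign n
  ratio' t q n p = subst (λ n → c n ≡ t · altSign n) (ℕP.m∸n+n≡m p) (ratio t q (n ℕ.∸ m))
  go : ∀ x y → c m ≡ x → altSign m ≡ y → EventuallyAlternating c
  go plus  plus  p q = inj₂ (m , ratio' plus (trans p (sym q)))
  go minus minus p q = inj₂ (m , ratio' plus (trans p (sym q)))
  go plus  minus p q = inj₁ (m , λ n r e → neg≢ (trans (sym (ratio' minus (trans p (cong neg (sym q))) n r)) e))
  go minus plus  p q = inj₁ (m , λ n r e → neg≢ (trans (sym (ratio' minus (trans p (cong neg (sym q))) n r)) e))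

-- The phase is normalised to begin with plus, by starting one level later if necessary.
EventuallyAlternating⇒alternating : ∀ c → EventuallyAlternating c → ∃[ m ] (∀ k → c (m ℕ.+ k) ≡ altSign k)
EventuallyAlternating⇒alternating c ec = begin-at (c (proj₁ r)) refl
  where
  r : ∃[ m ] ∀ n → m ℕ.≤ n → c (suc n) ≡ neg (c n)
  r = [ (λ { (m , f) → m , λ n p → trans (≢⇒neg (f (suc n) (ℕP.m≤n⇒m≤1+n p))) (cong neg (sym (≢⇒neg (f n p)))) })
      , (λ { (m , f) → m , λ n p → trans (f (suc n) (ℕP.m≤n⇒m≤1+n p)) (cong neg (sym (f n p))) }) ]′ ec
  run : ∀ m → proj₁ r ℕ.≤ m → c m ≡ plus → ∀ k → c (m ℕ.+ k) ≡ altSign k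
  run m p q zero    = trans (cong c (ℕP.+-identityʳ m)) q
  run m p q (suc k) = trans (cong c (ℕP.+-suc m k)) (trans (proj₂ r (m ℕ.+ k) (ℕP.m≤n⇒m≤n+o k p)) (cong neg (run m p q k)))
  begin-at : ∀ x → c (proj₁ r) ≡ x → ∃[ m ] (∀ k → c (m ℕ.+ k) ≡ altSign k)
  begin-at plus  q = proj₁ r , run (proj₁ r) ℕP.≤-refl q
  begin-at minus q = suc (proj₁ r) , run (suc (proj₁ r)) (ℕP.n≤1+n _) (trans (proj₂ r (proj₁ r) ℕP.≤-refl) (cong neg q))

-- Edges on the same curve and their ancestors.

module Orbits (a : Axis) (ε : Sign) where
  open Oriented a ε

  data Reach (c : ℕ → Sign) : ℕ → State → State → Set where
    done : ∀ {e} → Reach c 0 e e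
    step : ∀ {m e f} t → Turn c (endpoint e) t → Reach c m (nx t e) f → Reach c (suc m) e f

  ParReach : (ℕ → Sign) → ℕ → State → State → Set
  ParReach c m e f = ∃[ m' ] (m' ℕ.+ m' ℕ.≤ m × Reach (tail c) m' (parent (c 0) e) (parent (c 0) f))

  -- A step from an outgoing edge stays within one parent, a step from an incoming edge passes to
  -- the next parent. So the length is halved, rounded up when the start is incoming.
  reach-out : ∀ {c m e f} → isOut e ≡ true → Reach c m e f → ParReach c m e f
  reach-in  : ∀ {c m e f} → isOut e ≡ false → Reach c m e f → ParReach c (suc m) e f
  reach-out p done = 0 , ℕ.z≤n , done
  reach-out {c} {suc m} {e} {f} p (step t T r) =
    let (m' , b , r') = reach-in (trans (isOut-nx t e) (cong not p)) r
    in m' , b , subst (λ x → Reach (tail c) m' x (parent (c 0) f)) (parent-nx-out (c 0) t e p (turn-out e p T)) r'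
  reach-in p done = 0 , ℕ.z≤n , done
  reach-in {c} {suc m} {e} {f} p (step t T r) =
    let (m' , b , r') = reach-out (trans (isOut-nx t e) (cong not p)) r
    in suc m' , ℕ.s≤s (ℕP.≤-trans (ℕP.≤-reflexive (ℕP.+-suc m' m')) (ℕ.s≤s b)) ,
       step t (Turn-even-inv (subst (λ z → Turn c z t) (endpoint-parent (c 0) e p) T))
         (subst (λ x → Reach (tail c) m' x (parent (c 0) f)) (parent-nx-in (c 0) t e p) r')

  reach-parent : ∀ {c m e f} → Reach c m e f → ParReach c (suc m) e f
  reach-parent {e = e} r with isOut e in eq
  ... | true  = let (m' , b , r') = reach-out eq r in m' , ℕP.m≤n⇒m≤1+n b , r'
  ... | false = reach-in eq r

  -- The map from m to (m+1)/2, rounded down, lowers every length above 1 and fixes 1; this is why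
  -- `Near` has to allow consecutive edges.
  reach-ancestor : ∀ n {c m e f} → m ℕ.≤ suc n → Reach c m e f → ∃[ m' ] (m' ℕ.≤ 1 × Reach (from c n) m' (ancestor c n e) (ancestor c n f))
  reach-ancestor zero    p r = _ , p , r
  reach-ancestor (suc n) {c} {m} p r = let (m' , b , r') = reach-parent r in reach-ancestor n (bound m' b) r'
    where
    bound : ∀ m' → m' ℕ.+ m' ℕ.≤ suc m → m' ℕ.≤ suc n
    bound m' b with m' ℕ.≤? suc n
    ... | yes q = q
    ... | no  q = ⊥-elim (ℕP.<⇒≱ (ℕP.+-mono-≤ {2} {m'} {suc (suc n)} {m'} (ℕP.≤-trans (ℕ.s≤s (ℕ.s≤s ℕ.z≤n)) (ℕP.≰⇒> q)) (ℕP.≰⇒> q))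
                     (ℕP.≤-trans b (ℕ.s≤s p)))

  Near : (ℕ → Sign) → State → State → Set
  Near c e f = e ≡ f ⊎ (∃[ t ] (Turn c (endpoint e) t × f ≡ nx t e)) ⊎ (∃[ t ] (Turn c (endpoint f) t × e ≡ nx t f))

  reach-zero : ∀ {c e f} → Reach c 0 e f → e ≡ f
  reach-zero done = refl

  reach-near : ∀ {c m e f} → Reach c m e f → ∀ n → m ℕ.≤ n → Near (from c n) (ancestor c n e) (ancestor c n f)
  reach-near r n p with reach-ancestor n (ℕP.m≤n⇒m≤1+n p) r
  ... | zero , _ , r'              = inj₁ (reach-zero r')
  ... | suc zero , _ , step t T r' = inj₂ (inj₁ (t , T , sym (reach-zero r')))
  ... | suc (suc _) , ℕ.s≤s () , _

  near-sym : ∀ {c e f} → Near c e f → Near c f e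
  near-sym (inj₁ q)        = inj₁ (sym q)
  near-sym (inj₂ (inj₁ q)) = inj₂ (inj₂ q)
  near-sym (inj₂ (inj₂ q)) = inj₂ (inj₁ q)

  module _ {I : Set} where

    -- The intended φ sends an edge to its curve. A general φ is needed because the induction passes
    -- to φ composed with a choice of half.
    Inv : (ℕ → Sign) → (State → I) → Set
    Inv c φ = ∀ e t → Turn c (endpoint e) t → φ (nx t e) ≡ φ e

    inv-kids : ∀ {c φ} → Inv c φ → ∀ Q → φ (half-of (c 0) false Q) ≡ φ (half-of (c 0) true Q)
    inv-kids {c} {φ} inv Q = trans (cong φ (sym (nx-half-of-out (c 0) Q)))
      (inv o _ (turn-out-intro o (half-of-out (c 0) true Q) refl))
      where o = half-of (c 0) true Q

    inv-parent : ∀ {c φ} → Inv c φ → ∀ e → φ e ≡ φ (half-of (c 0) true (parent (c 0) e))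
    inv-parent {c} {φ} inv e with isOut e in eq
    ... | true  = cong φ (sym (trans (cong (λ b → half-of (c 0) b (parent (c 0) e)) (sym eq)) (half-of-parent (c 0) e)))
    ... | false = trans (cong φ (sym (half-of-in (c 0) e eq))) (inv-kids {c} {φ} inv (parent (c 0) e))

    inv-tail : ∀ {c φ} → Inv c φ → Inv (tail c) (φ ∘ half-of (c 0) true)
    inv-tail {c} {φ} inv Q t T = trans (cong φ (sym (nx-half-of-in (c 0) t Q)))
      (trans (inv (half-of (c 0) false Q) t (t-even (endpoint-half-of (c 0) Q) T)) (inv-kids {c} {φ} inv Q))

    -- The halves of an edge are successive, so φ takes the same value on both and induces an
    -- invariant of the next level.
    inv-ancestor : ∀ n {c φ} → Inv c φ → ∀ e f → ancestor c n e ≡ ancestor c n f → φ e ≡ φ f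
    inv-ancestor zero    {c} {φ} inv e f q = cong φ q
    inv-ancestor (suc n) {c} {φ} inv e f q = trans (inv-parent {c} {φ} inv e)
      (trans (inv-ancestor n {tail c} {φ ∘ half-of (c 0) true} (inv-tail {c} {φ} inv) (parent (c 0) e) (parent (c 0) f) q) (sym (inv-parent {c} {φ} inv f)))

  lift : (ℕ → Sign) → ℕ → State → State
  lift c zero    e = e
  lift c (suc n) e = half-of (c 0) true (lift (tail c) n e)

  ancestor-lift : ∀ n c e → ancestor c n (lift c n e) ≡ e
  ancestor-lift zero    c e = refl
  ancestor-lift (suc n) c e = trans (cong (ancestor (tail c) n) (parent-half-of (c 0) true (lift (tail c) n e))) (ancestor-lift n (tail c) e)

  negSt : State → State
  negSt (w , d) = (⊝ w , opp d)

  ⊝-⊕-distrib : ∀ u v → ⊝ (u ⊕ v) ≡ ⊝ u ⊕ ⊝ v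
  ⊝-⊕-distrib (x , y) (z , w) = p≡ (ℤP.neg-distrib-+ x z) (ℤP.neg-distrib-+ y w)

  δ-⊝ : ∀ s v → δ s (⊝ v) ≡ ⊝ δ s v
  δ-⊝ plus  v       = refl
  δ-⊝ minus (x , y) = refl

  nx-neg : ∀ s e → nx s (negSt e) ≡ negSt (nx s e)
  nx-neg s (w , d) rewrite out-opp d with out d
  ... | true  = cong₂ _,_ (trans (cong (⊝ w ⊕_) (trans (cong (δ s) (dirVec-opp d)) (δ-⊝ s (dirVec d)))) (sym (⊝-⊕-distrib w (δ s (dirVec d)))))
                          (cong opp (turnBy-opp s d))
  ... | false = cong (⊝ w ,_) (turnBy-opp s (opp d))

  endpoint-neg : ∀ e → endpoint (negSt e) ≡ ⊝ endpoint e
  endpoint-neg (w , d) rewrite out-opp d with out d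
  ... | true  = trans (cong₂ _⊕_ (β-⊝ plus w) (dirVec-opp d)) (sym (⊝-⊕-distrib (pt w) (dirVec d)))
  ... | false = β-⊝ plus w

  coord-⊝ : ∀ b z → coord b (⊝ z) ≡ - coord b z
  coord-⊝ horiz z = refl
  coord-⊝ vert  z = refl

  -- The prediction depends on parities only, so it is invariant under the half-turn about the
  -- origin. The image of C under this half-turn is the second curve with sequence S.
  Turn-⊝ : ∀ {c z t} → Turn c z t → Turn c (⊝ z) t
  Turn-⊝ (t-zero q r) = t-zero (cong ⊝_ q) r
  Turn-⊝ {c} {z} (t-odd p q) = t-odd (trans (parityP-⊝ z) p)
    (trans q (cong (c 0 ·_) (sym (trans (cong parityℤ (coord-⊝ a z)) (parityℤ-neg (coord a z))))))
  Turn-⊝ {c} (t-even {z'} q T) = t-even (trans (cong ⊝_ q) (sym (β-⊝ (c 0) z'))) (Turn-⊝ T)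

-- Counting the curves of the covering.

module Count (ε : Sign) (c : ℕ → Sign) (s : ℤ → Sign) (H : Hierarchy.Hier ε c s)
             (C : ℤ → Segment) (cc : IsCompleteCurve C) (as : ∀ i → assoc C i ≡ s i)
             (I : Set) (ι : I → ℤ → Segment)
             (cov : IsCovering I ι) (con : ContainsCurve I ι C) (loc : LocalIso I ι) where

  open Hierarchy ε
  open Cover ε c s H C cc as I ι cov con
  open Orbits a ε
  open Central
  open Follow

  stateAt : I → ℤ → State
  stateAt i k = stateOf (support (ι i k))

  owner : State → I
  owner e = proj₁ (look (edge e))

  pos-of : State → ℤ
  pos-of e = proj₂ (look (edge e))

  stateAt-owner : ∀ e → stateAt (owner e) (pos-of e) ≡ e
  stateAt-owner e = trans (cong stateOf (support-look (edge e))) (stateOf-edge e)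

  edge-stateAt : ∀ i k → edge (stateAt i k) ≡ support (ι i k)
  edge-stateAt i k = edge-stateOf (support (ι i k))

  owner-stateAt : ∀ i k → owner (stateAt i k) ≡ i
  owner-stateAt i k = cong proj₁ (look-unique (edge (stateAt i k)) i k (sym (edge-stateAt i k)))

  stateAt-inj : ∀ i k j l → stateAt i k ≡ stateAt j l → (i , k) ≡ (j , l)
  stateAt-inj i k j l q = ι-inj i k j l (trans (sym (edge-stateAt i k)) (trans (cong edge q) (edge-stateAt j l)))

  follow-at : ∀ i k → let F = follow loc (stateAt i k) in (idx F , pos F) ≡ (i , k)
  follow-at i k = ι-inj (idx F) (pos F) i k (trans (cong support (at F)) (trans (support-segment (stateAt i k)) (edge-stateAt i k)))
    where F = follow loc (stateAt i k)

  ι-segment : ∀ i k → ι i k ≡ segment (stateAt i k)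
  ι-segment i k = trans (cong (λ p → ι (proj₁ p) (proj₂ p)) (sym (follow-at i k))) (at (follow loc (stateAt i k)))

  stateAt-next : ∀ i k t → Turn c (endpoint (stateAt i k)) t → stateAt i (ℤ.suc k) ≡ nx t (stateAt i k)
  stateAt-next i k t T = trans (cong (λ p → stateOf (support (ι (proj₁ p) (ℤ.suc (proj₂ p))))) (sym (follow-at i k)))
    (trans (cong (λ x → stateOf (support (ι (idx F) x))) (ℤP.+-comm (+ 1) (pos F)))
      (trans (cong stateOf (next F)) (trans (stateOf-edge (nx (sgn F) (stateAt i k))) (cong (λ t → nx t (stateAt i k)) (Turn-unique (sgnTurn F) T)))))
    where F = follow loc (stateAt i k)

  assoc-stateAt : ∀ i k t → Turn c (endpoint (stateAt i k)) t → assoc (ι i) k ≡ t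
  assoc-stateAt i k t T = trans (cong₂ turn (cong proj₂ (ι-segment i k)) (cong proj₂ nxt)) (turn-turnBy t (proj₂ (segment (stateAt i k))))
    where
    nxt : ι i (ℤ.suc k) ≡ extend t (segment (stateAt i k))
    nxt = trans (ι-segment i (ℤ.suc k)) (trans (cong segment (stateAt-next i k t T)) (segment-nx t (stateAt i k)))

  owner-inv : Inv c owner
  owner-inv e t T = trans (cong owner (sym (trans (stateAt-next i k t T') (cong (nx t) (stateAt-owner e))))) (owner-stateAt i (ℤ.suc k))
    where
    i = owner e
    k = pos-of e
    T' : Turn c (endpoint (stateAt i k)) t
    T' = subst (λ e → Turn c (endpoint e) t) (sym (stateAt-owner e)) T

  owner-ancestor : ∀ n e f → ancestor c n e ≡ ancestor c n f → owner e ≡ owner f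
  owner-ancestor n = inv-ancestor n {c} {owner} owner-inv

  owner-O : ∀ n e d → ancestor c n e ≡ (O , d) → owner e ≡ owner (O , d)
  owner-O n e d q = owner-ancestor n e (O , d) (trans q (sym (ancestor-O c n d)))

  reach-stateAt : ∀ m i k → Reach c m (stateAt i k) (stateAt i (+ m + k))
  reach-stateAt zero    i k = subst (λ l → Reach c 0 (stateAt i k) (stateAt i l)) (sym (ℤP.+-identityˡ k)) done
  reach-stateAt (suc m) i k = step t T (subst₂ (Reach c m) (stateAt-next i k t T) (cong (stateAt i) (l (+ m) k)) (reach-stateAt m i (ℤ.suc k)))
    where
    tT = Turn-total (norm (endpoint (stateAt i k))) c (endpoint (stateAt i k)) ℕP.≤-refl
    t = proj₁ tT
    T = proj₂ tT
    l : ∀ m k → m + (+ 1 + k) ≡ + 1 + m + k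
    l = solve-∀

  difference : ∀ k l → ∃[ m ] (l ≡ + m + k ⊎ k ≡ + m + l)
  difference k l = go (l - k) refl
    where
    e1 : ∀ k l → l ≡ l - k + k
    e1 = solve-∀
    e2 : ∀ k l → k ≡ - (l - k) + l
    e2 = solve-∀
    go : ∀ x → l - k ≡ x → ∃[ m ] (l ≡ + m + k ⊎ k ≡ + m + l)
    go (+ m)     q = m , inj₁ (trans (e1 k l) (cong (_+ k) q))
    go -[1+ m ]  q = suc m , inj₂ (trans (e2 k l) (cong (λ x → - x + l) q))

  owner-near : ∀ e f → owner e ≡ owner f → ∃[ m ] (∀ n → m ℕ.≤ n → Near (from c n) (ancestor c n e) (ancestor c n f))
  owner-near e f q with difference (pos-of e) (pos-of f)
  ... | m , inj₁ r = m , reach-near (subst₂ (Reach c m) (stateAt-owner e) (trans (cong₂ stateAt q (sym r)) (stateAt-owner f)) (reach-stateAt m (owner e) (pos-of e)))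
  ... | m , inj₂ r = m , λ n p → near-sym
          (reach-near (subst₂ (Reach c m) (stateAt-owner f) (trans (cong₂ stateAt (sym q) (sym r)) (stateAt-owner e)) (reach-stateAt m (owner f) (pos-of f))) n p)

  -- The covering makes I × ℤ a copy of the set of edges, so equality of curves is decidable.
  _≟I_ : (i j : I) → Dec (i ≡ j)
  i ≟I j with stateAt i 0ℤ ≟St stateAt j 0ℤ
  ... | yes q = yes (cong proj₁ (stateAt-inj i 0ℤ j 0ℤ q))
  ... | no  q = no (λ r → q (cong (λ i → stateAt i 0ℤ) r))

  e⁺ e⁻ : State
  e⁺ = (O , d₁)
  e⁻ = (O , opp d₁)

  owner-centre-out : ∀ d → out d ≡ true → owner (O , d) ≡ owner e⁺ ⊎ owner (O , d) ≡ owner e⁻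
  owner-centre-out d p =
    [ (λ q → inj₁ (cong (λ d → owner (O , d)) q)) , (λ q → inj₂ (cong (λ d → owner (O , d)) q)) ]′ (sameAxis-cases d₁ d p)

  -- An edge arriving at the origin continues with the turn ε into one of the two edges leaving it.
  owner-centre : ∀ d → owner (O , d) ≡ owner e⁺ ⊎ owner (O , d) ≡ owner e⁻
  owner-centre d with out d in eq
  ... | true  = owner-centre-out d eq
  ... | false = [ (λ q → inj₁ (trans same q)) , (λ q → inj₂ (trans same q)) ]′ (owner-centre-out d' out-d')
    where
    d' = turnBy ε (opp d)
    out-d' : out d' ≡ true
    out-d' = trans (out-turnBy-opp ε d) (cong not eq)
    same : owner (O , d) ≡ owner (O , d')
    same = sym (trans (cong (λ b → owner (nxBy b ε (O , d))) (sym eq))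
             (owner-inv (O , d) ε (t-zero (cong (λ b → endpointBy b (O , d)) eq) refl)))

  -- Backwards, the curve through `Z k` is followed one step to the next edge of Z; since an edge
  -- has only one place in the covering, that curve is the given one.
  follows⇒ShiftEq : ∀ Z → Steps s Z → Turns c s Z → ShiftEq (assoc (ι (owner (Z 1ℤ)))) s
  follows⇒ShiftEq Z st T = q , λ k → assoc-stateAt i (k + q) (s k) (subst (λ e → Turn c (endpoint e) (s k)) (sym (on k)) (T k))
    where
    i = owner (Z 1ℤ)
    q = pos-of (Z 1ℤ) - + 1
    On : ℤ → Set
    On k = stateAt i (k + q) ≡ Z k
    up : ∀ k → On k → On (ℤ.suc k)
    up k p = trans (cong (stateAt i) (ℤP.+-assoc (+ 1) k q))
      (trans (stateAt-next i (k + q) (s k) (subst (λ e → Turn c (endpoint e) (s k)) (sym p) (T k)))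
        (trans (cong (nx (s k)) p) (sym (st k))))
    down : ∀ k → On (ℤ.suc k) → On k
    down k p = trans (cong₂ stateAt (sym (cong proj₁ jl)) (sym l≡)) (stateAt-owner (Z k))
      where
      j = owner (Z k)
      l = pos-of (Z k)
      jl : (j , ℤ.suc l) ≡ (i , ℤ.suc k + q)
      jl = stateAt-inj j (ℤ.suc l) i (ℤ.suc k + q)
        (trans (stateAt-next j l (s k) (subst (λ e → Turn c (endpoint e) (s k)) (sym (stateAt-owner (Z k))) (T k)))
          (trans (cong (nx (s k)) (stateAt-owner (Z k))) (trans (sym (st k)) (sym p))))
      l≡ : l ≡ k + q
      l≡ = trans (sym (pred-suc l)) (trans (cong (_- + 1) (trans (cong proj₂ jl) (ℤP.+-assoc (+ 1) k q))) (pred-suc (k + q)))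
    on : ∀ k → On k
    on = ℤ-ind On (down 0ℤ (trans (cong (stateAt i) (suc-pred (pos-of (Z 1ℤ)))) (stateAt-owner (Z 1ℤ)))) up down

  shift⁺ : ShiftEq (assoc (ι (owner e⁺))) s
  shift⁺ = subst (λ e → ShiftEq (assoc (ι (owner e))) s) (begin central) (follows⇒ShiftEq X (steps central) (Central-turns central))

  shift⁻ : ShiftEq (assoc (ι (owner e⁻))) s
  shift⁻ = subst (λ e → ShiftEq (assoc (ι (owner e))) s) (cong negSt (begin central))
    (follows⇒ShiftEq (negSt ∘ X)
      (λ k → trans (cong negSt (steps central k)) (sym (nx-neg (s k) (X k))))
      (λ k → subst (λ z → Turn c z (s k)) (sym (endpoint-neg (X k))) (Turn-⊝ (Central-turns central k))))

  ShiftEq⇒centre : ∀ i → ShiftEq (assoc (ι i)) s → i ≡ owner e⁺ ⊎ i ≡ owner e⁻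
  ShiftEq⇒centre i (q , f) = [ (λ r → inj₁ (trans i≡ r)) , (λ r → inj₂ (trans i≡ r)) ]′ (owner-centre (proj₂ (Z 0ℤ)))
    where
    Z : ℤ → State
    Z k = stateAt i (k + q)
    T : Turns c s Z
    T k = let (t , T') = Turn-total (norm (endpoint (Z k))) c (endpoint (Z k)) ℕP.≤-refl
          in subst (Turn c (endpoint (Z k))) (trans (sym (assoc-stateAt i (k + q) t T')) (f k)) T'
    st : Steps s Z
    st k = trans (cong (stateAt i) (ℤP.+-assoc (+ 1) k q)) (stateAt-next i (k + q) (s k) (T k))
    w≡O : proj₁ (Z 0ℤ) ≡ O
    w≡O = β-inj plus (trans (sym (endpoint-in (Z 0ℤ) (centre-in H st T))) (centre-at-O _ H st T ℕP.≤-refl))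
    i≡ : i ≡ owner (O , proj₂ (Z 0ℤ))
    i≡ = trans (sym (owner-stateAt i (0ℤ + q))) (cong (λ w → owner (w , proj₂ (Z 0ℤ))) w≡O)

  out-e⁻ : isOut e⁻ ≡ true
  out-e⁻ = trans (out-opp d₁) out-d₁

  e⁺-not-near-e⁻ : ∀ {c} → ¬ Near c e⁺ e⁻
  e⁺-not-near-e⁻ (inj₁ q) = d≢opp d₁ (cong proj₂ q)
  e⁺-not-near-e⁻ (inj₂ (inj₁ (t , _ , q))) with trans (sym out-e⁻) (trans (cong isOut q) (trans (isOut-nx t e⁺) (cong not out-d₁)))
  ... | ()
  e⁺-not-near-e⁻ (inj₂ (inj₂ (t , _ , q))) with trans (sym out-d₁) (trans (cong isOut q) (trans (isOut-nx t e⁻) (cong not out-e⁻)))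
  ... | ()

  -- Both edges are their own ancestors at every level, and two outgoing edges are never
  -- consecutive.
  own⁺≢own⁻ : ¬ owner e⁺ ≡ owner e⁻
  own⁺≢own⁻ q = let (m , f) = owner-near e⁺ e⁻ q in
    e⁺-not-near-e⁻ (subst₂ (Near (from c m)) (ancestor-O c m d₁) (ancestor-O c m (opp d₁)) (f m ℕP.≤-refl))

  mk-bijection : ∀ {n} (rep : Fin n → State) → (∀ j l → owner (rep j) ≡ owner (rep l) → j ≡ l) →
                 (∀ i → ∃[ j ] owner (rep j) ≡ i) → Fin n ↔ I
  mk-bijection rep inj surj = mk↔ₛ′ (owner ∘ rep) (proj₁ ∘ surj) (proj₂ ∘ surj) (λ j → inj _ j (proj₂ (surj (owner (rep j)))))

  module Unabsorbed (e : State) (free : ∀ n d → ¬ ancestor c n e ≡ (O , d)) where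

    n₀ : ℕ
    n₀ = norm (proj₁ e) ℕ.+ 5

    data Alive (n : ℕ) : Set where
      aliveA : ∀ d → ancestor c n e ≡ stA d → c n ≡ plus → Alive n
      aliveB : ∀ d → ancestor c n e ≡ stB d → c n ≡ minus → Alive n

    classify : ∀ n → Kind (ancestor c n e) → (∃[ d ] ancestor c n e ≡ stA d) ⊎ (∃[ d ] ancestor c n e ≡ stB d)
    classify n k = go k refl
      where
      go : ∀ {f} → Kind f → ancestor c n e ≡ f → (∃[ d ] ancestor c n e ≡ stA d) ⊎ (∃[ d ] ancestor c n e ≡ stB d)
      go (kO d) q = ⊥-elim (free n d q)
      go (kA d) q = inj₁ (d , q)
      go (kB d) q = inj₂ (d , q)

    alive : ∀ n → n₀ ℕ.≤ n → Alive n
    alive n p with classify n (ancestor-Kind-from c e n p) | c n in eq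
    ... | inj₁ (d , q) | plus  = aliveA d q eq
    ... | inj₁ (d , q) | minus = ⊥-elim (free (suc n) (right d) (trans (ancestor-suc c n e) (trans (cong₂ parent eq q) (parent-minus-A d))))
    ... | inj₂ (d , q) | plus  = ⊥-elim (free (suc n) (opp d) (trans (ancestor-suc c n e) (trans (cong₂ parent eq q) (parent-plus-B d))))
    ... | inj₂ (d , q) | minus = aliveB d q eq

    A≢B : ∀ d d' → ¬ stA d ≡ stB d'
    A≢B = toWitness {a? = ∀-dirs? λ d → ∀-dirs? λ d' → ¬? (stA d ≟St stB d')} tt

    alternate : ∀ n → n₀ ℕ.≤ n → c (suc n) ≡ neg (c n)
    alternate n p with alive n p | alive (suc n) (ℕP.m≤n⇒m≤1+n p)
    ... | aliveA d q r | aliveB _ _ r' = trans r' (cong neg (sym r))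
    ... | aliveB d q r | aliveA _ _ r' = trans r' (cong neg (sym r))
    ... | aliveA d q r | aliveA d' q' r' = ⊥-elim (A≢B d' d (trans (sym q') (trans (ancestor-suc c n e) (trans (cong₂ parent r q) (parent-plus-A d)))))
    ... | aliveB d q r | aliveB d' q' r' = ⊥-elim (A≢B d d' (trans (sym (trans (ancestor-suc c n e) (trans (cong₂ parent r q) (parent-minus-B d)))) q'))

  two-curves : ¬ EventuallyAlternating c → Σ (Fin 2 ↔ I) λ b → ∀ j → ShiftEq (assoc (ι (Inverse.to b j))) s
  two-curves nec = mk-bijection rep inj surj , shifts
    where
    rep : Fin 2 → State
    rep f0 = e⁺
    rep f1 = e⁻
    inj : ∀ j l → owner (rep j) ≡ owner (rep l) → j ≡ l
    inj f0 f0 _ = refl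
    inj f1 f1 _ = refl
    inj f0 f1 q = ⊥-elim (own⁺≢own⁻ q)
    inj f1 f0 q = ⊥-elim (own⁺≢own⁻ (sym q))
    surj : ∀ i → ∃[ j ] owner (rep j) ≡ i
    surj i with owner e⁺ ≟I i | owner e⁻ ≟I i
    ... | yes q | _     = f0 , q
    ... | no _  | yes q = f1 , q
    -- An edge of a third curve would never be absorbed by the origin, so the signs would eventually
    -- alternate.
    ... | no p  | no q  = ⊥-elim (nec (alternating⇒EventuallyAlternating c U.n₀ U.alternate))
      where
      free : ∀ n d → ¬ ancestor c n (stateAt i 0ℤ) ≡ (O , d)
      free n d r = [ (λ x → p (sym (trans i≡ x))) , (λ x → q (sym (trans i≡ x))) ]′ (owner-centre d)
        where
        i≡ : i ≡ owner (O , d)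
        i≡ = trans (sym (owner-stateAt i 0ℤ)) (owner-O n (stateAt i 0ℤ) d r)
      module U = Unabsorbed (stateAt i 0ℤ) free
    shifts : ∀ j → ShiftEq (assoc (ι (owner (rep j)))) s
    shifts f0 = shift⁺
    shifts f1 = shift⁻

  module Alternating (m : ℕ) (alt : ∀ k → c (m ℕ.+ k) ≡ altSign k) where

    dirOf : Fin 4 → Dir
    dirOf f0 = E
    dirOf f1 = N
    dirOf f2 = W
    dirOf f3 = S

    dirOf-surj : ∀ d → ∃[ j ] dirOf j ≡ d
    dirOf-surj E = f0 , refl
    dirOf-surj N = f1 , refl
    dirOf-surj W = f2 , refl
    dirOf-surj S = f3 , refl

    A-inj : ∀ j l → stA (dirOf j) ≡ stA (dirOf l) → j ≡ l
    A-inj j l q = trans (sym (inv j)) (trans (cong (λ e → proj₁ (dirOf-surj (proj₂ e))) q) (inv l))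
      where
      inv : ∀ j → proj₁ (dirOf-surj (dirOf j)) ≡ j
      inv f0 = refl
      inv f1 = refl
      inv f2 = refl
      inv f3 = refl

    -- `deep j` is the ancestor of `rep j` at each level m + 2k, where the sign is plus; at such
    -- levels the six states are pairwise neither equal nor consecutive.
    deep rep : Fin 6 → State
    deep f0          = e⁺
    deep f1          = e⁻
    deep (fs (fs j)) = stA (dirOf j)
    rep f0          = e⁺
    rep f1          = e⁻
    rep (fs (fs j)) = lift c m (stA (dirOf j))

    ancestor-rep : ∀ j k → ancestor c (m ℕ.+ twice k) (rep j) ≡ deep j
    ancestor-rep f0 k = ancestor-O c (m ℕ.+ twice k) d₁
    ancestor-rep f1 k = ancestor-O c (m ℕ.+ twice k) (opp d₁)
    ancestor-rep (fs (fs j)) k = trans (ancestor-+ c m (twice k) (lift c m A))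
      (trans (cong (ancestor (from c m) (twice k)) (ancestor-lift m c A)) (ancestor-A k (from c m) (dirOf j) alt))
      where A = stA (dirOf j)

    turn-O : ∀ {c' t d} → c' 0 ≡ plus → out d ≡ true → Turn c' (endpoint (O , d)) t → nx t (O , d) ≡ (O ⊕ dirVec d , opp (left d))
    turn-O {c'} {t} {d} p o T = trans (cong (λ b → nxBy b t (O , d)) o)
      (cong (λ t → nxBy true t (O , d)) (trans (turn-out (O , d) o T) (trans (·-plus (c' 0)) p)))

    not-next-O : ∀ {c' t d} j → c' 0 ≡ plus → out d ≡ true → Turn c' (endpoint (O , d)) t → ¬ deep j ≡ nx t (O , d)
    not-next-O {d = d} f0 p o T q = next-O≢O d d₁ (sym (trans q (turn-O p o T)))
    not-next-O {d = d} f1 p o T q = next-O≢O d (opp d₁) (sym (trans q (turn-O p o T)))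
    not-next-O {d = d} (fs (fs j)) p o T q = next-O≢A d (dirOf j) (sym (trans q (turn-O p o T)))

    not-next-A : ∀ {c' t} d j → c' 0 ≡ plus → Turn c' (endpoint (stA d)) t → ¬ deep j ≡ nx t (stA d)
    not-next-A {c'} {t} d j p T q with out d in eq
    ... | false = by-in j q
      where
      by-in : ∀ j → ¬ deep j ≡ (⊝ dirVec d , turnBy t (opp d))
      by-in f0 q = next-inA≢O t d d₁ (sym q)
      by-in f1 q = next-inA≢O t d (opp d₁) (sym q)
      by-in (fs (fs j)) q = next-inA≢A t d (dirOf j) (sym q)
    ... | true  = by-out j (trans q (cong (λ t → nxBy true t (stA d)) t≡))
      where
      t≡ : t ≡ minus
      t≡ = trans (turn-out (stA d) eq (subst (λ b → Turn c' (endpointBy b (stA d)) t) (sym eq) T))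
             (cong₂ _·_ p (trans (parityP-⊝ (dirVec d)) (parityP-dirVec d)))
      by-out : ∀ j → ¬ deep j ≡ (⊝ dirVec d ⊕ δ minus (dirVec d) , opp (right d))
      by-out f0 q = next-outA≢O d d₁ (sym q)
      by-out f1 q = next-outA≢O d (opp d₁) (sym q)
      by-out (fs (fs j)) q = next-outA≢A d (dirOf j) (sym q)

    not-next : ∀ {c' t} j l → c' 0 ≡ plus → Turn c' (endpoint (deep j)) t → ¬ deep l ≡ nx t (deep j)
    not-next f0 l p T = not-next-O l p out-d₁ T
    not-next f1 l p T = not-next-O l p out-e⁻ T
    not-next (fs (fs j)) l p T = not-next-A (dirOf j) l p T

    deep-inj : ∀ j l → deep j ≡ deep l → j ≡ l
    deep-inj f0 f0 q = refl
    deep-inj f1 f1 q = refl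
    deep-inj f0 f1 q = ⊥-elim (d≢opp d₁ (cong proj₂ q))
    deep-inj f1 f0 q = ⊥-elim (d≢opp d₁ (sym (cong proj₂ q)))
    deep-inj f0 (fs (fs l)) q = ⊥-elim (O≢A d₁ (dirOf l) q)
    deep-inj f1 (fs (fs l)) q = ⊥-elim (O≢A (opp d₁) (dirOf l) q)
    deep-inj (fs (fs j)) f0 q = ⊥-elim (O≢A d₁ (dirOf j) (sym q))
    deep-inj (fs (fs j)) f1 q = ⊥-elim (O≢A (opp d₁) (dirOf j) (sym q))
    deep-inj (fs (fs j)) (fs (fs l)) q = cong (λ x → fs (fs x)) (A-inj j l q)

    near-deep : ∀ {c'} j l → c' 0 ≡ plus → Near c' (deep j) (deep l) → j ≡ l
    near-deep j l p (inj₁ q)                  = deep-inj j l q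
    near-deep j l p (inj₂ (inj₁ (t , T , q))) = ⊥-elim (not-next j l p T q)
    near-deep j l p (inj₂ (inj₂ (t , T , q))) = ⊥-elim (not-next l j p T q)

    plus-at : ∀ k → c (m ℕ.+ twice k) ≡ plus
    plus-at k = trans (alt (twice k)) (altSign-twice k)

    rep-inj : ∀ j l → owner (rep j) ≡ owner (rep l) → j ≡ l
    rep-inj j l q = let (k , f) = owner-near (rep j) (rep l) q ; n = m ℕ.+ twice k in
      near-deep {from c n} j l (trans (cong c (ℕP.+-identityʳ n)) (plus-at k))
        (subst₂ (Near (from c n)) (ancestor-rep j k) (ancestor-rep l k) (f n (ℕP.≤-trans (n≤twice k) (ℕP.m≤n+m (twice k) m))))

    rep-surj : ∀ i → ∃[ j ] owner (rep j) ≡ i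
    rep-surj i = go (ancestor-Kind-from c e n (ℕP.≤-trans (n≤twice k) (ℕP.m≤n+m (twice k) m))) refl
      where
      e = stateAt i 0ℤ
      k = norm (proj₁ e) ℕ.+ 5
      n = m ℕ.+ twice k
      centre-rep : ∀ n d → ancestor c n e ≡ (O , d) → ∃[ j ] owner (rep j) ≡ i
      centre-rep n d q = [ (λ r → f0 , trans (sym r) i≡) , (λ r → f1 , trans (sym r) i≡) ]′ (owner-centre d)
        where
        i≡ : owner (O , d) ≡ i
        i≡ = trans (sym (owner-O n e d q)) (owner-stateAt i 0ℤ)
      go : ∀ {f} → Kind f → ancestor c n e ≡ f → ∃[ j ] owner (rep j) ≡ i
      go (kO d) q = centre-rep n d q
      go (kA d) q = fs (fs j) , trans (owner-ancestor n (rep (fs (fs j))) e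
          (trans (ancestor-rep (fs (fs j)) k) (trans (cong stA (proj₂ (dirOf-surj d))) (sym q)))) (owner-stateAt i 0ℤ)
        where j = proj₁ (dirOf-surj d)
      -- The sign at level n is plus, which sends this state to the origin one level later.
      go (kB d) q = centre-rep (suc n) (opp d) (trans (ancestor-suc c n e) (trans (cong₂ parent (plus-at k) q) (parent-plus-B d)))

    six-curves : Σ (Fin 6 ↔ I) λ b → ∀ j → ShiftEq (assoc (ι (Inverse.to b j))) s ⇔ toℕ j ℕ.< 2
    six-curves = mk-bijection rep rep-inj rep-surj , λ j → mk⇔ (only j) (shifts j)
      where
      only : ∀ j → ShiftEq (assoc (ι (owner (rep j)))) s → toℕ j ℕ.< 2
      only j sh = [ (λ q → subst (λ j → toℕ j ℕ.< 2) (rep-inj f0 j (sym q)) (ℕ.s≤s ℕ.z≤n))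
                  , (λ q → subst (λ j → toℕ j ℕ.< 2) (rep-inj f1 j (sym q)) (ℕ.s≤s (ℕ.s≤s ℕ.z≤n))) ]′ (ShiftEq⇒centre (owner (rep j)) sh)
      shifts : ∀ j → toℕ j ℕ.< 2 → ShiftEq (assoc (ι (owner (rep j)))) s
      shifts f0 _ = shift⁺
      shifts f1 _ = shift⁻
      shifts (fs (fs j)) (ℕ.s≤s (ℕ.s≤s ()))

theorem3p15 : (R : ℕ → Sign) → InfFolding R → (ε : Sign) →
    (C : ℤ → Segment) → IsCompleteCurve C → (∀ i → assoc C i ≡ twoSided R ε i) →
    (I : Set) → (ι : I → ℤ → Segment) →
    IsCovering I ι → ContainsCurve I ι C → LocalIso I ι →
    (FiniteOrCofinite R →
    Σ (Fin 6 ↔ I) (λ e → ∀ (j : Fin 6) →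
    (ShiftEq (assoc (ι (Inverse.to e j))) (twoSided R ε) ⇔ (toℕ j < 2))))
    × (¬ FiniteOrCofinite R →
    Σ (Fin 2 ↔ I) (λ e → ∀ (j : Fin 2) →
    ShiftEq (assoc (ι (Inverse.to e j))) (twoSided R ε)))
theorem3p15 R inf ε C cc as I ι cov con loc =
  (λ fc → let (m , alt) = EventuallyAlternating⇒alternating c fc in Count.Alternating.six-curves ε c s H C cc as I ι cov con loc m alt)
  , Count.two-curves ε c s H C cc as I ι cov con loc
  where
  c : ℕ → Sign
  c n = R (2 ℕ.^ n ℕ.∸ 1)
  s : ℤ → Sign
  s = twoSided R ε
  H = twoSided-Hier ε R inf
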